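{- Let $U$ be a finite set with $|U|=n$, let $w:U\to[0,\infty)$ satisfy $W=\sum_{a\in U}w(a)>0$, and let $\tilde n\ge 1$ and $0<\varepsilon<1$ be parameters. Let $\textsc{PropEstimator}(\tilde n,\varepsilon)$ be the procedure defined in the context, with output $\hat W$. Then $\textsc{PropEstimator}(\tilde n,\varepsilon)$ uses $O(\sqrt{\tilde n}/\varepsilon)$ proportional samples (with an absolute implied constant), and $E[1/\hat W]=1/W$. If, moreover, $\tilde n\ge n$, then $P(|\hat W-W|\le \varepsilon W)\ge 2/3$.
   Context: A proportional sample from $(U,w)$ is a random item $a\in U$ returned together with $w(a)$, where each $a$ is returned with probability $w(a)/W$; distinct samples are independent. Procedure $\textsc{PropEstimator}(\tilde n,\varepsilon)$: draw $m=\lceil \sqrt{24\tilde n}/\varepsilon\rceil+1$ independent proportional samples $a_1,\dots,a_m$. Let $S$ be the set of distinct sampled items and, for $s\in S$, let $c_s$ be the number of indices $i$ with $a_i=s$. Output $$\hat W=\binom m2\cdot\left(\sum_{s\in S}\frac{\binom{c_s}{2}}{w(s)}\right)^{ -1},$$ with $\hat W=\infty$ (and $1/\hat W=0$) if $c_s=1$ for all $s\in S$. -}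

module Defs where

open import Algebra.Bundles using (CommutativeRing)
open import Algebra.Core using (Op₁; Op₂)
open import Algebra.Structures using (IsCommutativeRing)
import Algebra.Definitions.RawMonoid as RawMonoidDefs
import Algebra.Solver.Ring.NaturalCoefficients.Default as SemiringSolver
open import Data.Bool.Base using (if_then_else_)
open import Data.Empty using (⊥-elim)
open import Data.Empty.Polymorphic using (⊥)
open import Data.Fin.Base using (Fin)
open import Data.Fin.Properties using (inj⇒≟)
open import Data.List.Base using (List; length; filter; deduplicate; foldr; map)
open import Data.List.Relation.Unary.All using (all?)
open import Data.Nat.Base as ℕ using (ℕ; zero; suc)
open import Data.Nat.Combinatorics using (_C_)
import Data.Nat.Properties as ℕ
open import Data.Product.Base using (∃; _×_; _,_; proj₁; proj₂)
open import Data.Sum.Base using (_⊎_; inj₁; inj₂)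
open import Data.Vec.Base using (Vec; []; _∷_; toList)
open import Function.Base using (_∘_)
open import Function.Bundles using (_↔_; module Inverse)
open import Function.Properties.Inverse using (↔⇒↣)
open import Level using (_⊔_) renaming (suc to lsuc)
open import Relation.Binary.Core using (Rel)
open import Relation.Binary.Definitions using (DecidableEquality)
open import Relation.Binary.Structures using (IsDecTotalOrder)
import Relation.Binary.Construct.NonStrictToStrict as ToStrict
open import Relation.Nullary using (¬_; Dec; yes; no)
open import Relation.Nullary.Decidable using (⌊_⌋)
open import Relation.Unary using (Pred; Decidable)

-- The real numbers, axiomatised as a Dedekind-complete ordered field.  The
-- supremum is the least upper bound in its approximation form: every b < s is
-- exceeded by a member.  Classically this is the usual notion; together with
-- the decidable order it yields excluded middle at level ℓ (`decide` below), so
-- the structure is the classical ℝ.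
record CompleteOrderedField c ℓ : Set (lsuc (c ⊔ ℓ)) where
  infix  8 -_
  infixl 7 _*_
  infixl 6 _+_
  infix  4 _≈_ _≤_
  field
    Carrier           : Set c
    _≈_ _≤_           : Rel Carrier ℓ
    _+_ _*_           : Op₂ Carrier
    -_                : Op₁ Carrier
    0# 1#             : Carrier
    isCommutativeRing : IsCommutativeRing _≈_ _+_ _*_ -_ 0# 1#
    isDecTotalOrder   : IsDecTotalOrder _≈_ _≤_
    0≉1               : ¬ 0# ≈ 1#
    *-inverse         : ∀ x → ¬ x ≈ 0# → ∃ λ y → x * y ≈ 1#
    +-monoʳ-≤         : ∀ z {x y} → x ≤ y → z + x ≤ z + y
    *-nonneg          : ∀ {x y} → 0# ≤ x → 0# ≤ y → 0# ≤ x * y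

  open ToStrict _≈_ _≤_ public using (_<_)

  field
    supremum : (P : Pred Carrier ℓ) → ∃ P → (∃ λ b → ∀ x → P x → x ≤ b) →
               ∃ λ s → (∀ x → P x → x ≤ s) ×
                       (∀ b → b < s → ∃ λ x → P x × b < x)

module RealArithmetic {c ℓ} (R : CompleteOrderedField c ℓ) where

  open CompleteOrderedField R public

  commutativeRing : CommutativeRing c ℓ
  commutativeRing = record { isCommutativeRing = isCommutativeRing }

  open CommutativeRing commutativeRing public
    using (_-_; +-comm; +-assoc; +-identityˡ; +-identityʳ; *-comm; *-assoc;
           *-identityʳ; *-identityˡ; zeroˡ; zeroʳ; -‿inverseʳ; +-cong; +-congˡ; +-congʳ;
           *-cong; *-congˡ; *-congʳ; distribˡ; distribʳ; setoid; refl; sym; trans)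
  open IsDecTotalOrder isDecTotalOrder public
    using (_≟_; _≤?_; total; antisym)
    renaming (refl to ≤-refl; reflexive to ≤-reflexive; trans to ≤-trans)
  open RawMonoidDefs (CommutativeRing.+-rawMonoid commutativeRing) public
    using (sum) renaming (_×_ to _·_)

  private
    module Id where
      open SemiringSolver (CommutativeRing.commutativeSemiring commutativeRing)

      [1+x]² : ∀ x → (1# + x) * (1# + x) ≈ x + (x + x * x) + 1#
      [1+x]² = solve 1 (λ x → (con 1 :+ x) :* (con 1 :+ x) := x :+ (x :+ x :* x) :+ con 1) refl

      [s+h]² : ∀ s h → s * s + (h * (s + s) + h * h) ≈ (s + h) * (s + h)
      [s+h]² = solve 2 (λ s h → s :* s :+ (h :* (s :+ s) :+ h :* h) := (s :+ h) :* (s :+ h)) refl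

      [s+s+1]h : ∀ s h → s * s + (s + s + 1#) * h ≈ s * s + (h * (s + s) + h * 1#)
      [s+s+1]h = solve 2 (λ s h →
        s :* s :+ (s :+ s :+ con 1) :* h := s :* s :+ (h :* (s :+ s) :+ h :* con 1)) refl

      [y+k]² : ∀ y k → (y + k) * (y + k) ≈ (y * k + y * k + k * k) + y * y
      [y+k]² = solve 2 (λ y k →
        (y :+ k) :* (y :+ k) := (y :* k :+ y :* k :+ k :* k) :+ y :* y) refl

      2[y+k]k : ∀ x y k → (y * k + y * k + k * k) + x + k * k ≈ x + ((y + k) + (y + k)) * k
      2[y+k]k = solve 3 (λ x y k →
        (y :* k :+ y :* k :+ k :* k) :+ x :+ k :* k := x :+ ((y :+ k) :+ (y :+ k)) :* k) refl

  ι : ℕ → Carrier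
  ι n = n · 1#

  infix  8 _⁻¹
  infixl 7 _/_

  -- Total inverse, with the convention 0⁻¹ = 0.
  _⁻¹ : Op₁ Carrier
  x ⁻¹ with x ≟ 0#
  ... | yes _   = 0#
  ... | no  x≉0 = proj₁ (*-inverse x x≉0)

  _/_ : Op₂ Carrier
  x / y = x * y ⁻¹

  ∣_∣ : Op₁ Carrier
  ∣ x ∣ = if ⌊ 0# ≤? x ⌋ then x else - x

  ≰⇒≥ : ∀ {x y} → ¬ x ≤ y → y ≤ x
  ≰⇒≥ {x} {y} x≰y with total x y
  ... | inj₁ x≤y = ⊥-elim (x≰y x≤y)
  ... | inj₂ y≤x = y≤x

  ≰⇒> : ∀ {x y} → ¬ x ≤ y → y < x
  ≰⇒> x≰y = ≰⇒≥ x≰y , λ y≈x → x≰y (≤-reflexive (sym y≈x))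

  <⇒≱ : ∀ {x y} → x < y → ¬ y ≤ x
  <⇒≱ (x≤y , x≉y) y≤x = x≉y (antisym x≤y y≤x)

  ≤-resp : ∀ {x x′ y y′} → x ≈ x′ → y ≈ y′ → x ≤ y → x′ ≤ y′
  ≤-resp x≈x′ y≈y′ x≤y =
    ≤-trans (≤-reflexive (sym x≈x′)) (≤-trans x≤y (≤-reflexive y≈y′))

  y+[x-y] : ∀ x y → y + (x - y) ≈ x
  y+[x-y] x y = trans (+-comm y (x - y)) (trans (+-assoc x (- y) y)
    (trans (+-congˡ (trans (+-comm (- y) y) (-‿inverseʳ y))) (+-identityʳ x)))

  +-cancelˡ-≤ : ∀ z {x y} → z + x ≤ z + y → x ≤ y
  +-cancelˡ-≤ z {x} {y} p = ≤-resp (lemma x) (lemma y) (+-monoʳ-≤ (- z) p)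
    where
    lemma : ∀ t → - z + (z + t) ≈ t
    lemma t = trans (sym (+-assoc (- z) z t))
      (trans (+-congʳ (trans (+-comm (- z) z) (-‿inverseʳ z))) (+-identityˡ t))

  x≤x+y : ∀ x {y} → 0# ≤ y → x ≤ x + y
  x≤x+y x 0≤y = ≤-resp (+-identityʳ x) refl (+-monoʳ-≤ x 0≤y)

  0≤y-x : ∀ {x y} → x ≤ y → 0# ≤ y - x
  0≤y-x {x} {y} x≤y = ≤-resp lemma (+-comm (- x) y) (+-monoʳ-≤ (- x) x≤y)
    where
    lemma : - x + x ≈ 0#
    lemma = trans (+-comm _ _) (-‿inverseʳ x)

  *-monoˡ-≤ : ∀ {z x y} → 0# ≤ z → x ≤ y → z * x ≤ z * y
  *-monoˡ-≤ {z} {x} {y} 0≤z x≤y =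
    ≤-resp refl (trans (sym (distribˡ z x (y - x))) (*-congˡ (y+[x-y] y x))) (x≤x+y (z * x) (*-nonneg 0≤z (0≤y-x x≤y)))

  +-nonneg : ∀ {x y} → 0# ≤ x → 0# ≤ y → 0# ≤ x + y
  +-nonneg {x} 0≤x 0≤y = ≤-trans 0≤x (x≤x+y x 0≤y)

  0≤1 : 0# ≤ 1#
  0≤1 with total 0# 1#
  ... | inj₁ p = p
  ... | inj₂ p = ≤-resp refl lemma (*-nonneg (0≤y-x p) (0≤y-x p))
    where
    m : Carrier
    m = 0# - 1#
    1+m≈0 : 1# + m ≈ 0#
    1+m≈0 = y+[x-y] 0# 1#
    lemma : m * m ≈ 1#
    lemma = trans (sym (+-identityˡ _)) (trans (+-congʳ (sym 1+m≈0)) (trans (+-assoc _ _ _)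
      (trans (+-congˡ (trans (+-congʳ (sym (*-identityʳ m))) (trans (sym (distribˡ m 1# m))
        (trans (*-congˡ 1+m≈0) (zeroʳ m))))) (+-identityʳ 1#))))

  0<1 : 0# < 1#
  0<1 = 0≤1 , 0≉1

  ⁻¹-inverseʳ : ∀ {x} → ¬ x ≈ 0# → x * x ⁻¹ ≈ 1#
  ⁻¹-inverseʳ {x} x≉0 with x ≟ 0#
  ... | yes x≈0 = ⊥-elim (x≉0 x≈0)
  ... | no  x≉0 = proj₂ (*-inverse x x≉0)

  ⁻¹-nonneg : ∀ {x} → 0# < x → 0# ≤ x ⁻¹
  ⁻¹-nonneg {x} (0≤x , 0≉x) with total 0# (x ⁻¹)
  ... | inj₁ p = p
  ... | inj₂ p = ⊥-elim (<⇒≱ 0<1 (≤-resp (⁻¹-inverseʳ (0≉x ∘ sym)) (zeroʳ x) (*-monoˡ-≤ 0≤x p)))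

  *-cancelˡ-≤ : ∀ {z x y} → 0# < z → z * x ≤ z * y → x ≤ y
  *-cancelˡ-≤ {z} 0<z@(_ , 0≉z) p = ≤-resp (lemma _) (lemma _) (*-monoˡ-≤ (⁻¹-nonneg 0<z) p)
    where
    lemma : ∀ t → z ⁻¹ * (z * t) ≈ t
    lemma t = trans (sym (*-assoc _ _ _))
      (trans (*-congʳ (trans (*-comm _ _) (⁻¹-inverseʳ (0≉z ∘ sym)))) (*-identityˡ t))

  a*[a⁻¹*d] : ∀ {a} d → 0# < a → a * (a ⁻¹ * d) ≈ d
  a*[a⁻¹*d] d (_ , 0≉a) = trans (sym (*-assoc _ _ _))
    (trans (*-congʳ (⁻¹-inverseʳ (0≉a ∘ sym))) (*-identityˡ d))

  x-y<x : ∀ x {y} → 0# < y → x - y < x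
  x-y<x x {y} 0<y@(0≤y , _) =
      ≤-resp refl [x-y]+y (x≤x+y (x - y) 0≤y)
    , λ eq → <⇒≱ 0<y (+-cancelˡ-≤ (x - y)
        (≤-reflexive (trans [x-y]+y (trans (sym eq) (sym (+-identityʳ _))))))
    where
    [x-y]+y : x - y + y ≈ x
    [x-y]+y = trans (+-comm _ _) (y+[x-y] x y)

  decide : (Q : Set ℓ) → Dec Q
  decide Q with supremum P (0# , inj₁ refl) (1# , bounded)
    where
    P : Pred Carrier ℓ
    P y = y ≈ 0# ⊎ (y ≈ 1# × Q)
    bounded : ∀ y → P y → y ≤ 1#
    bounded y (inj₁ y≈0)       = ≤-trans (≤-reflexive y≈0) 0≤1
    bounded y (inj₂ (y≈1 , _)) = ≤-reflexive y≈1
  ... | s , ub , approx with s ≤? 0#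
  ...   | yes s≤0 = no λ q → <⇒≱ 0<1 (≤-trans (ub 1# (inj₂ (refl , q))) s≤0)
  ...   | no  s≰0 with approx 0# (≰⇒> s≰0)
  ...     | y , inj₁ y≈0     , _ , 0≉y = ⊥-elim (0≉y (sym y≈0))
  ...     | y , inj₂ (_ , q) , _       = yes q

  archimedean : ∀ x → ∃ λ k → x ≤ ι k
  archimedean x with decide (∃ λ k → x ≤ ι k)
  ... | yes q  = q
  ... | no  ¬q = ⊥-elim (unbounded sup)
    where
    N : Pred Carrier ℓ
    N y = ∃ λ k → y ≤ ι k
    sup : ∃ λ s → (∀ y → N y → y ≤ s) × (∀ b → b < s → ∃ λ y → N y × b < y)
    sup = supremum N (0# , 0 , ≤-refl)
      (x , λ y (k , y≤k) → ≤-trans y≤k (≰⇒≥ λ x≤k → ¬q (k , x≤k)))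
    unbounded : ¬ (∃ λ s → (∀ y → N y → y ≤ s) × (∀ b → b < s → ∃ λ y → N y × b < y))
    unbounded (s , ub , approx) with approx (s - 1#) (x-y<x s 0<1)
    ... | y , (k , y≤k) , s-1<y = <⇒≱ s-1<y (≤-trans y≤k
      (+-cancelˡ-≤ 1# (≤-resp refl (sym (y+[x-y] s 1#)) (ub (ι (suc k)) (suc k , ≤-refl)))))

  private
    least : ∀ {p} {P : Pred ℕ p} → Decidable P → ∀ n → P n →
            ∃ λ k → P k × (∀ j → P j → k ℕ.≤ j)
    least P? zero    pn = 0 , pn , λ _ _ → ℕ.z≤n
    least P? (suc n) pn with P? 0
    ... | yes p₀ = 0 , p₀ , λ _ _ → ℕ.z≤n
    ... | no ¬p₀ with least (P? ∘ suc) n pn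
    ...   | k , pk , min = suc k , pk , λ where
      zero    p₀ → ⊥-elim (¬p₀ p₀)
      (suc j) pj → ℕ.s≤s (min j pj)

  ceiling : ∀ x → ∃ λ k → x ≤ ι k × (∀ j → x ≤ ι j → k ℕ.≤ j)
  ceiling x with archimedean x
  ... | k , x≤k = least (λ k → x ≤? ι k) k x≤k

  -- The least natural number that is at least x; for x > -1 this is the
  -- integer ceiling.
  ⌈_⌉ : Carrier → ℕ
  ⌈ x ⌉ = proj₁ (ceiling x)

  squareRoot : ∀ x → 0# ≤ x → ∃ λ s → 0# ≤ s × s * s ≈ x
  squareRoot x 0≤x = s , 0≤s , s*s≈x
    where
    P : Pred Carrier ℓ
    P y = y * y ≤ x

    0∈P : P 0#
    0∈P = ≤-resp (sym (zeroʳ 0#)) refl 0≤x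

    bounded : ∀ y → P y → y ≤ 1# + x
    bounded y y²≤x with y ≤? 1# + x
    ... | yes p = p
    ... | no  p = ⊥-elim (<⇒≱ 0<1 (+-cancelˡ-≤ (x + (x + x * x))
                    (≤-resp (Id.[1+x]² x) (sym (+-identityʳ _)) (≤-trans
                      (≤-trans (*-monoˡ-≤ 0≤b b≤y)
                        (≤-resp (*-comm y (1# + x)) refl (*-monoˡ-≤ (≤-trans 0≤b b≤y) b≤y)))
                      (≤-trans y²≤x (x≤x+y x (+-nonneg 0≤x (*-nonneg 0≤x 0≤x))))))))
      where
      0≤b : 0# ≤ 1# + x
      0≤b = +-nonneg 0≤1 0≤x
      b≤y : 1# + x ≤ y
      b≤y = ≰⇒≥ p

    sup : ∃ λ s → (∀ y → P y → y ≤ s) × (∀ b → b < s → ∃ λ y → P y × b < y)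
    sup = supremum P (0# , 0∈P) (1# + x , bounded)

    s : Carrier
    s = proj₁ sup

    ub : ∀ y → P y → y ≤ s
    ub = proj₁ (proj₂ sup)

    0≤s : 0# ≤ s
    0≤s = ub 0# 0∈P

    s²≮x : ¬ s * s < x
    s²≮x (s²≤x , s²≉x) = step (t ≤? 1#)
      where
      d a t : Carrier
      d = x - s * s
      a = s + s + 1#
      t = a ⁻¹ * d

      s²+d≈x : s * s + d ≈ x
      s²+d≈x = y+[x-y] x (s * s)

      0≤s+s : 0# ≤ s + s
      0≤s+s = +-nonneg 0≤s 0≤s

      0<a : 0# < a
      0<a = +-nonneg 0≤s+s 0≤1 , λ 0≈a →
        <⇒≱ 0<1 (≤-resp refl (sym 0≈a) (≤-resp refl (+-comm _ _) (x≤x+y 1# 0≤s+s)))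

      a*t≈d : a * t ≈ d
      a*t≈d = a*[a⁻¹*d] d 0<a

      0≤d : 0# ≤ d
      0≤d = 0≤y-x s²≤x

      d≉0 : ¬ d ≈ 0#
      d≉0 d≈0 = s²≉x (trans (sym (+-identityʳ _)) (trans (+-congˡ (sym d≈0)) s²+d≈x))

      improve : ∀ h → 0# ≤ h → h ≤ 1# → a * h ≤ d → h ≤ 0#
      improve h 0≤h h≤1 ah≤d = +-cancelˡ-≤ s (≤-resp refl (sym (+-identityʳ s)) (ub (s + h)
        (≤-trans (≤-resp (Id.[s+h]² s h) refl (+-monoʳ-≤ (s * s) (+-monoʳ-≤ (h * (s + s)) (*-monoˡ-≤ 0≤h h≤1))))
          (≤-trans (≤-reflexive (sym (Id.[s+s+1]h s h))) (≤-resp refl s²+d≈x (+-monoʳ-≤ (s * s) ah≤d))))))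

      step : ¬ Dec (t ≤ 1#)
      step (yes t≤1) = d≉0 (antisym
        (≤-resp a*t≈d (zeroʳ a) (*-monoˡ-≤ (proj₁ 0<a)
          (improve t (*-nonneg (⁻¹-nonneg 0<a) 0≤d) t≤1 (≤-reflexive a*t≈d)))) 0≤d)
      step (no t≰1) = <⇒≱ 0<1
        (improve 1# 0≤1 ≤-refl (≤-resp refl a*t≈d (*-monoˡ-≤ (proj₁ 0<a) (≰⇒≥ t≰1))))

    x≮s² : ¬ x < s * s
    x≮s² (x≤s² , x≉s²) = overshoot (proj₂ (proj₂ sup) (s - h) (x-y<x s 0<h))
      where
      d a h : Carrier
      d = s * s - x
      a = s + s
      h = a ⁻¹ * d

      s≉0 : ¬ s ≈ 0#
      s≉0 s≈0 = x≉s² (antisym x≤s² (≤-resp (sym (trans (*-congʳ s≈0) (zeroˡ s))) refl 0≤x))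

      0<a : 0# < a
      0<a = +-nonneg 0≤s 0≤s , λ 0≈a →
        s≉0 (antisym (≤-resp refl (sym 0≈a) (x≤x+y s 0≤s)) 0≤s)

      0<h : 0# < h
      0<h = *-nonneg (⁻¹-nonneg 0<a) (0≤y-x x≤s²) , λ 0≈h →
        x≉s² (trans (sym (+-identityʳ x))
          (trans (+-congˡ (trans (sym (zeroʳ a)) (trans (*-congˡ 0≈h) (a*[a⁻¹*d] d 0<a))))
            (y+[x-y] (s * s) x)))

      overshoot : ¬ (∃ λ y → P y × s - h < y)
      overshoot (y , y²≤x , s-h<y) = <⇒≱ s-h<y
        (+-cancelˡ-≤ h (≤-resp (+-comm y h) (trans y+k≈s (sym (y+[x-y] s h)))
          (+-monoʳ-≤ y (*-cancelˡ-≤ 0<a (≤-resp (sym (a*[a⁻¹*d] d 0<a)) refl d≤ak)))))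
        where
        k e : Carrier
        k = s - y
        e = y * k + y * k + k * k
        y+k≈s : y + k ≈ s
        y+k≈s = y+[x-y] s y
        0≤k : 0# ≤ k
        0≤k = 0≤y-x (ub y y²≤x)
        d≤ak : d ≤ a * k
        d≤ak = +-cancelˡ-≤ x (≤-trans
          (≤-resp
            (trans (sym (Id.[y+k]² y k)) (trans (*-cong y+k≈s y+k≈s) (sym (y+[x-y] (s * s) x))))
            refl
            (+-monoʳ-≤ e y²≤x))
          (≤-resp refl
            (trans (Id.2[y+k]k x y k) (+-congˡ (*-congʳ (+-cong y+k≈s y+k≈s))))
            (x≤x+y (e + x) (*-nonneg 0≤k 0≤k))))

    s*s≈x : s * s ≈ x
    s*s≈x with total (s * s) x | s * s ≟ x
    ... | _          | yes s²≈x = s²≈x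
    ... | inj₁ s²≤x | no  s²≉x = ⊥-elim (s²≮x (s²≤x , s²≉x))
    ... | inj₂ x≤s² | no  s²≉x = ⊥-elim (x≮s² (x≤s² , s²≉x ∘ sym))

  -- The nonnegative square root; by convention 0 at negative arguments.
  √_ : Op₁ Carrier
  √ x with 0# ≤? x
  ... | yes 0≤x = proj₁ (squareRoot x 0≤x)
  ... | no  _   = 0#

  data Extended : Set c where
    fin : Carrier → Extended
    ∞   : Extended

  recip : Extended → Carrier
  recip (fin x) = x ⁻¹
  recip ∞       = 0#

  dist : Extended → Carrier → Extended
  dist (fin x) y = fin ∣ x - y ∣
  dist ∞       y = ∞

  infix 4 _≤∞_ _≤∞?_

  _≤∞_ : Extended → Carrier → Set ℓ
  fin x ≤∞ y = x ≤ y
  ∞     ≤∞ y = ⊥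

  _≤∞?_ : ∀ x y → Dec (x ≤∞ y)
  fin x ≤∞? y = x ≤? y
  ∞     ≤∞? y = no λ ()

-- Algorithms returning an A whose only access to the outside world is drawing
-- samples from X.  Each draw node is a fresh sample.
data Sampler {x a} (X : Set x) (A : Set a) : Set (x ⊔ a) where
  return : A → Sampler X A
  draw   : (X → Sampler X A) → Sampler X A

module _ {x a} {X : Set x} {A : Set a} where

  drawVec : ∀ m → (Vec X m → Sampler X A) → Sampler X A
  drawVec zero    k = k []
  drawVec (suc m) k = draw λ x → drawVec m λ xs → k (x ∷ xs)

  data UsesAtMost : ℕ → Sampler X A → Set (x ⊔ a) where
    return : ∀ {k y} → UsesAtMost k (return y)
    draw   : ∀ {k f} → (∀ s → UsesAtMost k (f s)) → UsesAtMost (suc k) (draw f)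

-- The algorithm sees an item and its weight only when the item is sampled, and
-- can compare items for equality.
module Estimator {c ℓ} (R : CompleteOrderedField c ℓ)
                 {u} {U : Set u} (_≟ᵁ_ : DecidableEquality U) where

  open RealArithmetic R

  Sample : Set (u ⊔ c)
  Sample = U × Carrier

  distinct : List Sample → List Sample
  distinct = deduplicate λ s t → proj₁ s ≟ᵁ proj₁ t

  multiplicity : List Sample → Sample → ℕ
  multiplicity as s = length (filter (λ t → proj₁ s ≟ᵁ proj₁ t) as)

  -- Division by a weight 0 does not matter here: an item of weight 0 is
  -- sampled with probability 0.
  estimate : ℕ → List Sample → Extended
  estimate m as =
    if ⌊ all? (λ s → multiplicity as s ℕ.≟ 1) S ⌋
    then ∞
    else fin (ι (m C 2) * (foldr _+_ 0# (map (λ s → ι (multiplicity as s C 2) / proj₂ s) S)) ⁻¹)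
    where
    S : List Sample
    S = distinct as

  sampleSize : Carrier → Carrier → ℕ
  sampleSize ñ ε = ⌈ √ (ι 24 * ñ) / ε ⌉ ℕ.+ 1

  propEstimator : Carrier → Carrier → Sampler Sample Extended
  propEstimator ñ ε = drawVec m λ as → return (estimate m (toList as))
    where
    m : ℕ
    m = sampleSize ñ ε

module ProportionalSampling {c ℓ} (R : CompleteOrderedField c ℓ)
                            {u} {U : Set u} {n : ℕ} (enum : U ↔ Fin n)
                            (w : U → CompleteOrderedField.Carrier R) where

  open RealArithmetic R

  open Estimator R (inj⇒≟ (↔⇒↣ enum)) public

  ∑ : (U → Carrier) → Carrier
  ∑ f = sum (f ∘ Inverse.from enum)

  W : Carrier
  W = ∑ w

  module _ {a} {A : Set a} where

    -- Expectation of f applied to the output, when every draw independently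
    -- yields (a , w a) with probability w a / W.
    𝔼 : Sampler Sample A → (A → Carrier) → Carrier
    𝔼 (return y) f = f y
    𝔼 (draw k)   f = ∑ λ a → w a / W * 𝔼 (k (a , w a)) f

    ℙ : ∀ {p} {B : Pred A p} → Sampler Sample A → Decidable B → Carrier
    ℙ s B? = 𝔼 s λ y → if ⌊ B? y ⌋ then 1# else 0#

{-# OPTIONS --safe #-}
-- Put p = w / W and let N a count the occurrences of a among the m samples.
-- Then W / Ŵ = Y / b with b = C(m,2) and Y = Σ_a C(N a , 2) / p a, and Y has
-- mean b.  Two pairs of sample positions sharing one index contribute
-- uncorrelated terms, so the second moment of Y is at most b² + n b.  If Ŵ is
-- not within ε W of W then |Y - b| > ε b / 2, which by Chebyshev has
-- probability at most 4 n / (ε² b) ≤ 1/3 for the chosen m.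
module Submission where

open import Defs
open import Algebra.Bundles using (CommutativeRing; CommutativeSemiring)
import Algebra.Properties.Semiring.Mult as Mult
import Algebra.Properties.Semiring.Sum as Sum
import Algebra.Solver.Ring.NaturalCoefficients.Default as SemiringSolver
open import Data.Bool.Base using (if_then_else_)
open import Data.Empty using (⊥-elim)
open import Data.Fin.Base using (Fin; zero; suc)
import Data.Fin.Properties as Fin
open import Data.List.Base as List using (List; filter; foldr)
open import Data.List.Relation.Unary.All as All using (All; all?)
import Data.List.Relation.Unary.All.Properties as All
open import Data.Nat.Base as ℕ using (ℕ; zero; suc)
open import Data.Nat.Combinatorics using (_C_; nC1≡n; nCk+nC[k+1]≡[n+1]C[k+1])
import Data.Nat.Properties as ℕ
open import Data.Product.Base using (∃; _×_; _,_; proj₁; proj₂)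
open import Data.Sum.Base using (inj₁; inj₂)
open import Data.Vec.Base as Vec using (Vec; []; _∷_; count; toList)
open import Function.Base using (_∘_)
open import Function.Bundles using (_↔_; module Inverse)
open import Function.Properties.Inverse using (↔⇒↣)
open import Relation.Binary.Bundles using (Poset)
open import Relation.Binary.Definitions using (DecidableEquality)
import Relation.Binary.Reasoning.PartialOrder as PosetReasoning
open import Relation.Binary.PropositionalEquality as ≡ using (_≡_; _≢_)
open import Relation.Binary.Structures using (IsDecTotalOrder)
open import Relation.Nullary using (¬_; Dec; yes; no; does)
open import Relation.Nullary.Decidable using (¬?; ⌊_⌋)

-- Pairs of sample positions never appear explicitly. Draws are added one at a time: a new item x
-- adds the number of its earlier copies divided by p x to Y, and both moments follow by induction
-- on m. The uncorrelatedness of overlapping pairs becomes the fact that this increment, averaged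
-- over x alone, is essentially the constant m whatever the earlier draws were. The recurring
-- obstacle is an item of probability 0, where `p a * p a ⁻¹` is 0 instead of 1. The second moment
-- only needs that this product is at most 1. In the mean a further factor `p a` remains, so the
-- value is still exact and the items need no case split. Inequalities are stated with negative
-- terms carried to the other side, since the solver works over a commutative semiring.

module RealProperties {c ℓ} (R : CompleteOrderedField c ℓ) where

  open RealArithmetic R public

  commutativeSemiring : CommutativeSemiring c ℓ
  commutativeSemiring = CommutativeRing.commutativeSemiring commutativeRing

  open CommutativeSemiring commutativeSemiring public using (semiring)
  open SemiringSolver commutativeSemiring public
    using (Polynomial; solve; con; _:+_; _:*_; _:=_)
  open Mult semiring using (×-homo-+)

  poset : Poset c ℓ ℓ
  poset = record { isPartialOrder = IsDecTotalOrder.isPartialOrder isDecTotalOrder }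

  module ≤-Reasoning = PosetReasoning poset
  open ≤-Reasoning

  -- Ordered-field arithmetic.

  ≡⇒≈ : ∀ {x y : Carrier} → x ≡ y → x ≈ y
  ≡⇒≈ ≡.refl = refl

  +-monoˡ-≤ : ∀ z {x y} → x ≤ y → x + z ≤ y + z
  +-monoˡ-≤ z x≤y = ≤-resp (+-comm z _) (+-comm z _) (+-monoʳ-≤ z x≤y)

  +-mono-≤ : ∀ {x y u v} → x ≤ y → u ≤ v → x + u ≤ y + v
  +-mono-≤ {y = y} {u = u} x≤y u≤v = ≤-trans (+-monoˡ-≤ u x≤y) (+-monoʳ-≤ y u≤v)

  +-cancelʳ-≤ : ∀ z {x y} → x + z ≤ y + z → x ≤ y
  +-cancelʳ-≤ z x+z≤y+z = +-cancelˡ-≤ z (≤-resp (+-comm _ z) (+-comm _ z) x+z≤y+z)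

  *-monoʳ-≤ : ∀ {z x y} → 0# ≤ z → x ≤ y → x * z ≤ y * z
  *-monoʳ-≤ 0≤z x≤y = ≤-resp (*-comm _ _) (*-comm _ _) (*-monoˡ-≤ 0≤z x≤y)

  *-mono-≤ : ∀ {x y u v} → 0# ≤ u → 0# ≤ y → x ≤ y → u ≤ v → x * u ≤ y * v
  *-mono-≤ 0≤u 0≤y x≤y u≤v = ≤-trans (*-monoʳ-≤ 0≤u x≤y) (*-monoˡ-≤ 0≤y u≤v)

  *-cancelʳ-≤ : ∀ {z x y} → 0# < z → x * z ≤ y * z → x ≤ y
  *-cancelʳ-≤ 0<z xz≤yz = *-cancelˡ-≤ 0<z (≤-resp (*-comm _ _) (*-comm _ _) xz≤yz)

  <-≤-trans : ∀ {x y z} → x < y → y ≤ z → x < z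
  <-≤-trans (x≤y , x≉y) y≤z =
    ≤-trans x≤y y≤z , λ x≈z → x≉y (antisym x≤y (≤-resp refl (sym x≈z) y≤z))

  *-positive : ∀ {x y} → 0# < x → 0# < y → 0# < x * y
  *-positive 0<x 0<y =
    *-nonneg (proj₁ 0<x) (proj₁ 0<y) ,
    λ 0≈xy → <⇒≱ 0<y (*-cancelˡ-≤ 0<x (≤-reflexive (trans (sym 0≈xy) (sym (zeroʳ _)))))

  +-halve-≤ : ∀ {x y} → x + x ≤ y + y → x ≤ y
  +-halve-≤ {x} {y} x+x≤y+y with x ≤? y
  ... | yes x≤y = x≤y
  ... | no  x≰y = +-cancelˡ-≤ x (≤-trans x+x≤y+y (+-monoˡ-≤ y (≰⇒≥ x≰y)))

  square-cancel-≤ : ∀ {x y} → 0# ≤ y → x * x ≤ y * y → x ≤ y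
  square-cancel-≤ {x} {y} 0≤y x²≤y² with x ≤? y
  ... | yes x≤y = x≤y
  ... | no  x≰y = *-cancelʳ-≤ (0≤x , λ 0≈x → x≰y (≤-resp 0≈x refl 0≤y))
    (≤-trans x²≤y² (*-monoˡ-≤ 0≤y y≤x))
    where
    y≤x : y ≤ x
    y≤x = ≰⇒≥ x≰y
    0≤x : 0# ≤ x
    0≤x = ≤-trans 0≤y y≤x

  ∣x-y∣≤k : ∀ {x y k} → x ≤ y + k → y ≤ x + k → ∣ x - y ∣ ≤ k
  ∣x-y∣≤k {x} {y} {k} x≤y+k y≤x+k with 0# ≤? x - y
  ... | yes _ = +-cancelˡ-≤ y (≤-resp (sym (y+[x-y] x y)) refl x≤y+k)
  ... | no  _ = +-cancelˡ-≤ (x - y) (≤-resp (sym (-‿inverseʳ _)) refl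
    (+-cancelˡ-≤ y (≤-resp (sym (+-identityʳ y)) y+[[x-y]+k] y≤x+k)))
    where
    y+[[x-y]+k] : x + k ≈ y + ((x - y) + k)
    y+[[x-y]+k] = trans (+-congʳ (sym (y+[x-y] x y))) (+-assoc y (x - y) k)

  -- Naturals, binomial coefficients and squares in the field.

  ι-+ : ∀ m n → ι (m ℕ.+ n) ≈ ι m + ι n
  ι-+ = ×-homo-+ 1#

  -- The solver's numeral for ι n, which unlike con n evaluates to ι n judgementally.
  ι′ : ∀ {k} → ℕ → Polynomial k
  ι′ zero    = con 0
  ι′ (suc n) = con 1 :+ ι′ n

  ι-nonneg : ∀ n → 0# ≤ ι n
  ι-nonneg zero    = ≤-refl
  ι-nonneg (suc n) = +-nonneg 0≤1 (ι-nonneg n)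

  ι-positive : ∀ n → 0# < ι (suc n)
  ι-positive n = <-≤-trans 0<1 (x≤x+y 1# (ι-nonneg n))

  ι-mono : ∀ {m n} → m ℕ.≤ n → ι m ≤ ι n
  ι-mono {n = n} ℕ.z≤n = ι-nonneg n
  ι-mono (ℕ.s≤s m≤n)   = +-monoʳ-≤ 1# (ι-mono m≤n)

  ι-[1+m]C2 : ∀ m → ι (suc m C 2) ≈ ι m + ι (m C 2)
  ι-[1+m]C2 m = begin-equality
    ι (suc m C 2)          ≡⟨ ≡.cong ι (nCk+nC[k+1]≡[n+1]C[k+1] m 1) ⟨
    ι (m C 1 ℕ.+ m C 2)    ≈⟨ ι-+ (m C 1) (m C 2) ⟩
    ι (m C 1) + ι (m C 2)  ≡⟨ ≡.cong (λ j → ι j + ι (m C 2)) (nC1≡n m) ⟩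
    ι m + ι (m C 2)        ∎

  -- The right side is exactly k² + k. This is the use of the extra sample in `sampleSize`: k
  -- samples would only give k² - k, with a lower-order loss to absorb.
  k²≤2[1+k]C2 : ∀ k → ι k * ι k ≤ ι 2 * ι (suc k C 2)
  k²≤2[1+k]C2 zero    = ≤-reflexive (solve 0 (con 0 :* con 0 := ι′ 2 :* con 0) refl)
  k²≤2[1+k]C2 (suc k) = begin
    (1# + ι k) * (1# + ι k)               ≤⟨ x≤x+y _ 0≤1 ⟩
    (1# + ι k) * (1# + ι k) + 1#          ≈⟨ solve 1 (λ x → (con 1 :+ x) :* (con 1 :+ x) :+ con 1
           := ι′ 2 :* (con 1 :+ x) :+ x :* x)
         refl (ι k) ⟩
    ι 2 * ι (suc k) + ι k * ι k           ≤⟨ +-monoʳ-≤ _ (k²≤2[1+k]C2 k) ⟩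
    ι 2 * ι (suc k) + ι 2 * ι (suc k C 2) ≈⟨ distribˡ (ι 2) _ _ ⟨
    ι 2 * (ι (suc k) + ι (suc k C 2))     ≈⟨ *-congˡ (ι-[1+m]C2 (suc k)) ⟨
    ι 2 * ι (suc (suc k) C 2)             ∎

  -- This is e² ≤ (x - y)² with the cross term carried to the left, the pointwise form of
  -- Chebyshev's inequality outside the good event.
  e²+2xy≤x²+y² : ∀ {e x y} → 0# ≤ e → y + e ≤ x → e * e + (x * y + x * y) ≤ y * y + x * x
  e²+2xy≤x²+y² {e} {x} {y} 0≤e y+e≤x = begin
    e * e + (x * y + x * y)
      ≤⟨ +-monoˡ-≤ _ (*-mono-≤ 0≤e 0≤t e≤t e≤t) ⟩
    t * t + (x * y + x * y)
      ≈⟨ +-congˡ (+-cong (*-congʳ y+t≈x) (*-congʳ y+t≈x)) ⟨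
    t * t + ((y + t) * y + (y + t) * y)
      ≈⟨ solve 2 (λ y t → t :* t :+ ((y :+ t) :* y :+ (y :+ t) :* y) := y :* y :+ (y :+ t) :* (y :+ t))
           refl y t ⟩
    y * y + (y + t) * (y + t)
      ≈⟨ +-congˡ (*-cong y+t≈x y+t≈x) ⟩
    y * y + x * x ∎
    where
    t : Carrier
    t = x - y
    y+t≈x : y + t ≈ x
    y+t≈x = y+[x-y] x y
    e≤t : e ≤ t
    e≤t = +-cancelˡ-≤ y (≤-resp refl (sym y+t≈x) y+e≤x)
    0≤t : 0# ≤ t
    0≤t = ≤-trans 0≤e e≤t

  2xy≤x²+y² : ∀ x y → x * y + x * y ≤ y * y + x * x
  2xy≤x²+y² x y with total y x
  ... | inj₁ y≤x = ≤-resp (trans (+-congʳ (zeroˡ 0#)) (+-identityˡ _)) refl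
    (e²+2xy≤x²+y² ≤-refl (≤-resp (sym (+-identityʳ y)) refl y≤x))
  ... | inj₂ x≤y = ≤-resp
    (trans (+-congʳ (zeroˡ 0#)) (trans (+-identityˡ _) (+-cong (*-comm y x) (*-comm y x))))
    (+-comm _ _)
    (e²+2xy≤x²+y² ≤-refl (≤-resp (sym (+-identityʳ x)) refl x≤y))

  -- The total inverse: laws that survive the convention 0⁻¹ = 0.

  ⁻¹-zero : ∀ {x} → x ≈ 0# → x ⁻¹ ≈ 0#
  ⁻¹-zero {x} x≈0 with x ≟ 0#
  ... | yes _   = refl
  ... | no  x≉0 = ⊥-elim (x≉0 x≈0)

  ⁻¹-unique : ∀ {x y} → x * y ≈ 1# → x ⁻¹ ≈ y
  ⁻¹-unique {x} {y} xy≈1 = begin-equality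
    x ⁻¹            ≈⟨ *-identityʳ _ ⟨
    x ⁻¹ * 1#       ≈⟨ *-congˡ xy≈1 ⟨
    x ⁻¹ * (x * y)  ≈⟨ *-assoc _ _ _ ⟨
    x ⁻¹ * x * y    ≈⟨ *-congʳ (trans (*-comm _ _) (⁻¹-inverseʳ x≉0)) ⟩
    1# * y          ≈⟨ *-identityˡ y ⟩
    y               ∎
    where
    x≉0 : ¬ x ≈ 0#
    x≉0 x≈0 = 0≉1 (trans (sym (zeroˡ y)) (trans (*-congʳ (sym x≈0)) xy≈1))

  ⁻¹-nonneg₀ : ∀ {x} → 0# ≤ x → 0# ≤ x ⁻¹
  ⁻¹-nonneg₀ {x} 0≤x with 0# ≟ x
  ... | yes 0≈x = ≤-reflexive (sym (⁻¹-zero (sym 0≈x)))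
  ... | no  0≉x = ⁻¹-nonneg (0≤x , 0≉x)

  x*x⁻¹≤1 : ∀ x → x * x ⁻¹ ≤ 1#
  x*x⁻¹≤1 x with 0# ≟ x
  ... | yes 0≈x = ≤-resp (trans (sym (zeroˡ _)) (*-congʳ 0≈x)) refl 0≤1
  ... | no  0≉x = ≤-reflexive (⁻¹-inverseʳ (0≉x ∘ sym))

  x*[x⁻¹*x]≈x : ∀ x → x * (x ⁻¹ * x) ≈ x
  x*[x⁻¹*x]≈x x with 0# ≟ x
  ... | yes 0≈x = trans (*-congʳ (sym 0≈x)) (trans (zeroˡ _) 0≈x)
  ... | no  0≉x = trans (*-congˡ (trans (*-comm _ _) (⁻¹-inverseʳ (0≉x ∘ sym)))) (*-identityʳ x)

  ⁻¹-involutive : ∀ x → (x ⁻¹) ⁻¹ ≈ x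
  ⁻¹-involutive x with 0# ≟ x
  ... | yes 0≈x = trans (⁻¹-zero (⁻¹-zero (sym 0≈x))) 0≈x
  ... | no  0≉x = ⁻¹-unique (trans (*-comm _ _) (⁻¹-inverseʳ (0≉x ∘ sym)))

  ⁻¹-distrib-* : ∀ x y → (x * y) ⁻¹ ≈ x ⁻¹ * y ⁻¹
  ⁻¹-distrib-* x y with 0# ≟ x | 0# ≟ y
  ... | yes 0≈x | _       = trans (⁻¹-zero (trans (*-congʳ (sym 0≈x)) (zeroˡ y)))
    (sym (trans (*-congʳ (⁻¹-zero (sym 0≈x))) (zeroˡ _)))
  ... | no _    | yes 0≈y = trans (⁻¹-zero (trans (*-congˡ (sym 0≈y)) (zeroʳ x)))
    (sym (trans (*-congˡ (⁻¹-zero (sym 0≈y))) (zeroʳ _)))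
  ... | no 0≉x  | no 0≉y  = ⁻¹-unique (begin-equality
    x * y * (x ⁻¹ * y ⁻¹)    ≈⟨ solve 4 (λ a b d e → a :* b :* (d :* e) := a :* d :* (b :* e))
         refl x y (x ⁻¹) (y ⁻¹) ⟩
    x * x ⁻¹ * (y * y ⁻¹)    ≈⟨ *-cong (⁻¹-inverseʳ (0≉x ∘ sym)) (⁻¹-inverseʳ (0≉y ∘ sym)) ⟩
    1# * 1#                  ≈⟨ *-identityʳ 1# ⟩
    1#                       ∎)

  x/y*y≈x : ∀ x {y} → 0# < y → x / y * y ≈ x
  x/y*y≈x x {y} (_ , 0≉y) = trans (*-assoc _ _ _)
    (trans (*-congˡ (trans (*-comm _ _) (⁻¹-inverseʳ (0≉y ∘ sym)))) (*-identityʳ x))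

  √-nonneg : ∀ x → 0# ≤ √ x
  √-nonneg x with 0# ≤? x
  ... | yes 0≤x = proj₁ (proj₂ (squareRoot x 0≤x))
  ... | no  _   = ≤-refl

  √-square : ∀ {x} → 0# ≤ x → √ x * √ x ≈ x
  √-square {x} 0≤x with 0# ≤? x
  ... | yes 0≤x = proj₂ (proj₂ (squareRoot x 0≤x))
  ... | no  0≰x = ⊥-elim (0≰x 0≤x)

  ⌈x⌉≤1+x : ∀ {x} → 0# ≤ x → ι ⌈ x ⌉ ≤ 1# + x
  ⌈x⌉≤1+x {x} 0≤x with ceiling x
  ... | zero  , _ , _     = +-nonneg 0≤1 0≤x
  ... | suc k , _ , least =
    -- If x were at most `ι k`, minimality of `suc k` would give `suc k` ≤ `k`.
    +-monoʳ-≤ 1# (≰⇒≥ λ x≤k → ℕ.<-irrefl ≡.refl (least k x≤k))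

  -- The size of m and of C(m,2).

  module SampleSize {ñ ε : Carrier} (1≤ñ : 1# ≤ ñ) (0<ε : 0# < ε) (ε<1 : ε < 1#) where

    s : Carrier
    s = √ (ι 24 * ñ)

    k : ℕ
    k = ⌈ s / ε ⌉

    0≤ñ : 0# ≤ ñ
    0≤ñ = ≤-trans 0≤1 1≤ñ

    s²≈24ñ : s * s ≈ ι 24 * ñ
    s²≈24ñ = √-square (*-nonneg (ι-nonneg 24) 0≤ñ)

    -- The rounding up gives s ≤ k ε; squaring and C(k+1,2) ≥ k²/2 do the rest. The constant is 24 =
    -- 2 · 4 · 3: 2 for this binomial bound, 4 for the squared half in the tolerance ε b / 2, and 3
    -- for the failure probability 1/3.
    24ñ≤2ε²b : ι 24 * ñ ≤ ε * ε * (ι 2 * ι ((k ℕ.+ 1) C 2))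
    24ñ≤2ε²b = begin
      ι 24 * ñ                               ≈⟨ s²≈24ñ ⟨
      s * s                                  ≤⟨ *-mono-≤ 0≤s 0≤kε s≤kε s≤kε ⟩
      (ι k * ε) * (ι k * ε)                  ≈⟨ solve 2 (λ x y → (x :* y) :* (x :* y) := y :* y :* (x :* x))
           refl (ι k) ε ⟩
      ε * ε * (ι k * ι k)                    ≤⟨ *-monoˡ-≤ (*-nonneg (proj₁ 0<ε) (proj₁ 0<ε)) (k²≤2[1+k]C2 k) ⟩
      ε * ε * (ι 2 * ι (suc k C 2))          ≡⟨ ≡.cong (λ m → ε * ε * (ι 2 * ι (m C 2))) (ℕ.+-comm 1 k) ⟩
      ε * ε * (ι 2 * ι ((k ℕ.+ 1) C 2))      ∎
      where
      0≤s : 0# ≤ s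
      0≤s = √-nonneg _
      0≤kε : 0# ≤ ι k * ε
      0≤kε = *-nonneg (ι-nonneg k) (proj₁ 0<ε)
      s≤kε : s ≤ ι k * ε
      s≤kε = ≤-resp (x/y*y≈x s 0<ε) refl (*-monoʳ-≤ (proj₁ 0<ε) (proj₁ (proj₂ (ceiling (s / ε)))))

    0<b : 0# < ι ((k ℕ.+ 1) C 2)
    0<b = ι-nonneg ((k ℕ.+ 1) C 2) , λ 0≈b → <⇒≱ (*-positive (ι-positive 23) (<-≤-trans 0<1 1≤ñ))
      (≤-resp refl (trans (*-congˡ (trans (*-congˡ (sym 0≈b)) (zeroʳ _))) (zeroʳ _)) 24ñ≤2ε²b)

    -- 7 = 1 + 1 + 5: the extra sample and the rounding cost one unit each, both at most √ñ / ε
    -- because ε < 1 ≤ ñ, and √24 is bounded by 5.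
    m≤7√ñ/ε : ι (k ℕ.+ 1) ≤ ι 7 * (√ ñ / ε)
    m≤7√ñ/ε = begin
      ι (k ℕ.+ 1)           ≡⟨ ≡.cong ι (ℕ.+-comm k 1) ⟩
      1# + ι k              ≤⟨ +-monoʳ-≤ 1# (⌈x⌉≤1+x (*-nonneg (√-nonneg _) 0≤ε⁻¹)) ⟩
      1# + (1# + s / ε)     ≤⟨ +-mono-≤ 1≤q (+-mono-≤ 1≤q (*-monoʳ-≤ 0≤ε⁻¹ s≤5√ñ)) ⟩
      q + (q + ι 5 * √ ñ * ε ⁻¹) ≈⟨ solve 2 (λ y z → y :* z :+ (y :* z :+ ι′ 5 :* y :* z) := ι′ 7 :* (y :* z))
           refl (√ ñ) (ε ⁻¹) ⟩
      ι 7 * q               ∎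
      where
      q : Carrier
      q = √ ñ / ε
      0≤ε⁻¹ : 0# ≤ ε ⁻¹
      0≤ε⁻¹ = ⁻¹-nonneg 0<ε
      1≤√ñ : 1# ≤ √ ñ
      1≤√ñ = square-cancel-≤ (√-nonneg ñ) (≤-resp (sym (*-identityʳ 1#)) (sym (√-square 0≤ñ)) 1≤ñ)
      1≤q : 1# ≤ q
      1≤q = *-cancelʳ-≤ 0<ε (≤-resp (sym (*-identityˡ ε)) (sym (x/y*y≈x (√ ñ) 0<ε))
        (≤-trans (proj₁ ε<1) 1≤√ñ))
      s≤5√ñ : s ≤ ι 5 * √ ñ
      s≤5√ñ = square-cancel-≤ (*-nonneg (ι-nonneg 5) (√-nonneg ñ)) (begin
        s * s                          ≈⟨ s²≈24ñ ⟩
        ι 24 * ñ                       ≤⟨ *-monoʳ-≤ 0≤ñ (ι-mono (ℕ.n≤1+n 24)) ⟩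
        ι 25 * ñ                       ≈⟨ *-congˡ (√-square 0≤ñ) ⟨
        ι 25 * (√ ñ * √ ñ)             ≈⟨ solve 1 (λ x → ι′ 25 :* (x :* x) := ι′ 5 :* x :* (ι′ 5 :* x))
             refl (√ ñ) ⟩
        ι 5 * √ ñ * (ι 5 * √ ñ)        ∎)

-- Occurrence counts and deduplication.

module Occurrences {c ℓ} (R : CompleteOrderedField c ℓ)
                   {u} {U : Set u} (_≟ᵁ_ : DecidableEquality U) where

  open RealProperties R public
  open Estimator R _≟ᵁ_ public

  δ : U → U → Carrier
  δ a b = if does (a ≟ᵁ b) then 1# else 0#

  δ-≢ : ∀ {a b} → a ≢ b → δ a b ≈ 0#
  δ-≢ {a} {b} a≢b with a ≟ᵁ b
  ... | yes a≡b = ⊥-elim (a≢b a≡b)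
  ... | no  _   = refl

  δ-refl : ∀ a → δ a a ≈ 1#
  δ-refl a with a ≟ᵁ a
  ... | yes _   = refl
  ... | no  a≢a = ⊥-elim (a≢a ≡.refl)

  δ-idem : ∀ a b → δ a b * δ a b ≈ δ a b
  δ-idem a b with a ≟ᵁ b
  ... | yes _ = *-identityʳ 1#
  ... | no  _ = zeroʳ 0#

  occ : ∀ {m} → U → Vec U m → ℕ
  occ a = count (a ≟ᵁ_)

  ι-occ-∷ : ∀ {m} a x (xs : Vec U m) → ι (occ a (x ∷ xs)) ≈ δ a x + ι (occ a xs)
  ι-occ-∷ a x xs with a ≟ᵁ x
  ... | yes _ = refl
  ... | no  _ = sym (+-identityˡ _)

  ι-occC2-∷ : ∀ {m} a x (xs : Vec U m) →
              ι (occ a (x ∷ xs) C 2) ≈ δ a x * ι (occ a xs) + ι (occ a xs C 2)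
  ι-occC2-∷ a x xs with a ≟ᵁ x
  ... | no  _ = sym (trans (+-congʳ (zeroˡ _)) (+-identityˡ _))
  ... | yes _ = trans (ι-[1+m]C2 (occ a xs)) (+-congʳ (sym (*-identityˡ _)))

  ι-multiplicity-∷ : ∀ t L s →
    ι (multiplicity (t List.∷ L) s) ≈ δ (proj₁ s) (proj₁ t) + ι (multiplicity L s)
  ι-multiplicity-∷ t L s with proj₁ s ≟ᵁ proj₁ t
  ... | yes _ = refl
  ... | no  _ = sym (+-identityˡ _)

  multiplicity-map : ∀ {m} (w : U → Carrier) (xs : Vec U m) s →
    multiplicity (toList (Vec.map (λ a → a , w a) xs)) s ≡ occ (proj₁ s) xs
  multiplicity-map w []       s = ≡.refl
  multiplicity-map w (x ∷ xs) s with proj₁ s ≟ᵁ x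
  ... | yes _ = ≡.cong suc (multiplicity-map w xs s)
  ... | no  _ = multiplicity-map w xs s

  -- The filter inside `deduplicate`: `distinct` of a list with head t and tail L unfolds to t
  -- followed by `without t (distinct L)`.
  without : Sample → List Sample → List Sample
  without t = filter λ r → ¬? (proj₁ t ≟ᵁ proj₁ r)

  multiplicity-without-≡ : ∀ t L s → proj₁ s ≡ proj₁ t → multiplicity (without t L) s ≡ 0
  multiplicity-without-≡ t List.[]      s s≡t = ≡.refl
  multiplicity-without-≡ t (r List.∷ L) s s≡t with proj₁ t ≟ᵁ proj₁ r
  ... | yes _   = multiplicity-without-≡ t L s s≡t
  ... | no  t≢r with proj₁ s ≟ᵁ proj₁ r
  ...   | yes s≡r = ⊥-elim (t≢r (≡.trans (≡.sym s≡t) s≡r))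
  ...   | no  _   = multiplicity-without-≡ t L s s≡t

  multiplicity-without-≢ : ∀ t L s → proj₁ s ≢ proj₁ t →
                           multiplicity (without t L) s ≡ multiplicity L s
  multiplicity-without-≢ t List.[]      s s≢t = ≡.refl
  multiplicity-without-≢ t (r List.∷ L) s s≢t with proj₁ t ≟ᵁ proj₁ r
  ... | yes t≡r with proj₁ s ≟ᵁ proj₁ r
  ...   | yes s≡r = ⊥-elim (s≢t (≡.trans s≡r (≡.sym t≡r)))
  ...   | no  _   = multiplicity-without-≢ t L s s≢t
  multiplicity-without-≢ t (r List.∷ L) s s≢t | no _ with proj₁ s ≟ᵁ proj₁ r
  ...   | yes _ = ≡.cong suc (multiplicity-without-≢ t L s s≢t)
  ...   | no  _ = multiplicity-without-≢ t L s s≢t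

  -- The minimum with 1 is the indicator that the item of s occurs in L. It is the coefficient that
  -- turns the estimator's sum over distinct samples into a sum over all of U.
  multiplicity-distinct : ∀ L s → multiplicity (distinct L) s ≡ 1 ℕ.⊓ multiplicity L s
  multiplicity-distinct List.[]      s = ≡.refl
  multiplicity-distinct (t List.∷ L) s with proj₁ s ≟ᵁ proj₁ t
  ... | yes s≡t = ≡.cong suc (multiplicity-without-≡ t (distinct L) s s≡t)
  ... | no  s≢t =
    ≡.trans (multiplicity-without-≢ t (distinct L) s s≢t) (multiplicity-distinct L s)

-- Finite sums over U.

module FiniteSum {c ℓ} (R : CompleteOrderedField c ℓ)
                 {u} {U : Set u} {n : ℕ} (enum : U ↔ Fin n) where

  open Inverse enum using (to; from; inverseˡ; inverseʳ)
  open Occurrences R (Fin.inj⇒≟ (↔⇒↣ enum)) public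

  private module FinSum = Sum semiring

  sum-mono : ∀ {k} {f g : Fin k → Carrier} → (∀ i → f i ≤ g i) → sum f ≤ sum g
  sum-mono {zero}  f≤g = ≤-refl
  sum-mono {suc k} f≤g = +-mono-≤ (f≤g zero) (sum-mono (f≤g ∘ suc))

  sum-zero : ∀ {k} {f : Fin k → Carrier} → (∀ i → f i ≈ 0#) → sum f ≈ 0#
  sum-zero {k} f≈0 = trans (FinSum.sum-cong-≋ f≈0) (FinSum.sum-replicate-zero k)

  sum-single : ∀ {k} {f : Fin k → Carrier} j → (∀ i → i ≢ j → f i ≈ 0#) → sum f ≈ f j
  sum-single zero    f≈0 =
    trans (+-congˡ (sum-zero λ i → f≈0 (suc i) λ ())) (+-identityʳ _)
  sum-single (suc j) f≈0 =
    trans (+-cong (f≈0 zero λ ()) (sum-single j λ i i≢j → f≈0 (suc i) (i≢j ∘ Fin.suc-injective)))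
      (+-identityˡ _)

  -- Opaque, so that f can be inferred from ∑ f.
  opaque

    ∑ : (U → Carrier) → Carrier
    ∑ f = sum (f ∘ from)

    ∑-def : ∀ f → ∑ f ≡ sum (f ∘ from)
    ∑-def f = ≡.refl

    ∑-cong : ∀ {f g} → (∀ a → f a ≈ g a) → ∑ f ≈ ∑ g
    ∑-cong f≈g = FinSum.sum-cong-≋ (f≈g ∘ from)

    ∑-mono : ∀ {f g} → (∀ a → f a ≤ g a) → ∑ f ≤ ∑ g
    ∑-mono f≤g = sum-mono (f≤g ∘ from)

    ∑-nonneg : ∀ {f} → (∀ a → 0# ≤ f a) → 0# ≤ ∑ f
    ∑-nonneg 0≤f = ≤-resp (FinSum.sum-replicate-zero n) refl (sum-mono (0≤f ∘ from))

    ∑-distrib-+ : ∀ f g → ∑ (λ a → f a + g a) ≈ ∑ f + ∑ g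
    ∑-distrib-+ f g = FinSum.∑-distrib-+ (f ∘ from) (g ∘ from)

    ∑-*ˡ : ∀ x f → ∑ (λ a → x * f a) ≈ x * ∑ f
    ∑-*ˡ x f = sym (FinSum.*-distribˡ-sum x (f ∘ from))

    ∑-*ʳ : ∀ x f → ∑ (λ a → f a * x) ≈ ∑ f * x
    ∑-*ʳ x f = sym (FinSum.*-distribʳ-sum x (f ∘ from))

    ∑-1 : ∑ (λ _ → 1#) ≈ ι n
    ∑-1 = FinSum.sum-replicate n

    ∑-comm : ∀ (f : U → U → Carrier) → ∑ (λ a → ∑ (f a)) ≈ ∑ (λ b → ∑ λ a → f a b)
    ∑-comm f = FinSum.∑-comm λ i j → f (from i) (from j)

    ∑-single : ∀ {f} x → (∀ a → a ≢ x → f a ≈ 0#) → ∑ f ≈ f x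
    ∑-single {f} x f≈0 = trans
      (sum-single (to x) λ i i≢to → f≈0 (from i) (i≢to ∘ ≡.sym ∘ inverseˡ ∘ ≡.sym))
      (≡.subst (λ a → f (from (to x)) ≈ f a) (inverseʳ ≡.refl) refl)

  ∑-δˡ : ∀ x (f : U → Carrier) → ∑ (λ a → δ a x * f a) ≈ f x
  ∑-δˡ x f = trans (∑-single x λ a a≢x → trans (*-congʳ (δ-≢ a≢x)) (zeroˡ _))
    (trans (*-congʳ (δ-refl x)) (*-identityˡ _))

  ∑-δʳ : ∀ x (f : U → Carrier) → ∑ (λ a → f a * δ x a) ≈ f x
  ∑-δʳ x f = trans (∑-single x λ a a≢x → trans (*-congˡ (δ-≢ (a≢x ∘ ≡.sym))) (zeroʳ _))
    (trans (*-congˡ (δ-refl x)) (*-identityʳ _))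

-- Moments of the weighted collision count.

module Collisions {c ℓ} (R : CompleteOrderedField c ℓ)
                  {u} {U : Set u} {n : ℕ} (enum : U ↔ Fin n)
                  (p : U → CompleteOrderedField.Carrier R) where

  open FiniteSum R enum public
  open ≤-Reasoning

  -- For a with p a = 0 the convention 0⁻¹ = 0 removes the term.
  collisions : ∀ {m} → Vec U m → Carrier
  collisions xs = ∑ λ a → ι (occ a xs C 2) * p a ⁻¹

  -- A new x forms one colliding pair with each copy of x in xs, by Pascal's rule, so only the
  -- summand at x changes. Both moment computations are inductions along this recursion.
  collisions-∷ : ∀ {m} x (xs : Vec U m) →
                 collisions (x ∷ xs) ≈ p x ⁻¹ * ι (occ x xs) + collisions xs
  collisions-∷ x xs = begin-equality
    ∑ (λ a → ι (occ a (x ∷ xs) C 2) * p a ⁻¹)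
      ≈⟨ ∑-cong (λ a → trans (*-congʳ (ι-occC2-∷ a x xs))
           (solve 4 (λ d k c q → (d :* k :+ c) :* q := d :* (q :* k) :+ c :* q) refl
             (δ a x) (ι (occ a xs)) (ι (occ a xs C 2)) (p a ⁻¹))) ⟩
    ∑ (λ a → δ a x * (p a ⁻¹ * ι (occ a xs)) + ι (occ a xs C 2) * p a ⁻¹)
      ≈⟨ ∑-distrib-+ _ _ ⟩
    ∑ (λ a → δ a x * (p a ⁻¹ * ι (occ a xs))) + collisions xs
      ≈⟨ +-congʳ (∑-δˡ x λ a → p a ⁻¹ * ι (occ a xs)) ⟩
    p x ⁻¹ * ι (occ x xs) + collisions xs ∎

  ∑-occ : ∀ {m} (xs : Vec U m) → ∑ (λ a → ι (occ a xs)) ≈ ι m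
  ∑-occ []       = trans (∑-cong λ _ → sym (zeroˡ 0#)) (trans (∑-*ˡ 0# _) (zeroˡ _))
  ∑-occ {suc m} (x ∷ xs) = begin-equality
    ∑ (λ a → ι (occ a (x ∷ xs)))
      ≈⟨ ∑-cong (λ a → trans (ι-occ-∷ a x xs) (+-congʳ (sym (*-identityʳ _)))) ⟩
    ∑ (λ a → δ a x * 1# + ι (occ a xs))
      ≈⟨ ∑-distrib-+ _ _ ⟩
    ∑ (λ a → δ a x * 1#) + ∑ (λ a → ι (occ a xs))
      ≈⟨ +-cong (∑-δˡ x λ _ → 1#) (∑-occ xs) ⟩
    1# + ι m ∎

  opaque

    -- Iterated sums with the first draw outermost, instead of one sum over all vectors: this
    -- matches the recursions for `occ` and `collisions`, and linearity reduces to that of `∑`.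
    𝔼ⱽ : ∀ {m} → (Vec U m → Carrier) → Carrier
    𝔼ⱽ {zero}  g = g []
    𝔼ⱽ {suc m} g = ∑ λ x → p x * 𝔼ⱽ {m} λ xs → g (x ∷ xs)

    𝔼ⱽ-zero : ∀ (g : Vec U 0 → Carrier) → 𝔼ⱽ g ≡ g []
    𝔼ⱽ-zero g = ≡.refl

    𝔼ⱽ-suc : ∀ {m} (g : Vec U (suc m) → Carrier) →
             𝔼ⱽ g ≡ ∑ λ x → p x * 𝔼ⱽ λ xs → g (x ∷ xs)
    𝔼ⱽ-suc g = ≡.refl

    𝔼ⱽ-cong : ∀ {m} {f g : Vec U m → Carrier} → (∀ xs → f xs ≈ g xs) → 𝔼ⱽ f ≈ 𝔼ⱽ g
    𝔼ⱽ-cong {zero}  f≈g = f≈g []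
    𝔼ⱽ-cong {suc m} f≈g = ∑-cong λ x → *-congˡ (𝔼ⱽ-cong {m} λ xs → f≈g (x ∷ xs))

    𝔼ⱽ-*ˡ : ∀ {m} k (f : Vec U m → Carrier) → 𝔼ⱽ (λ xs → k * f xs) ≈ k * 𝔼ⱽ f
    𝔼ⱽ-*ˡ {zero}  k f = refl
    𝔼ⱽ-*ˡ {suc m} k f = trans
      (∑-cong λ x → trans (*-congˡ (𝔼ⱽ-*ˡ {m} k _))
        (solve 3 (λ a b d → a :* (b :* d) := b :* (a :* d)) refl (p x) k _))
      (∑-*ˡ k _)

    𝔼ⱽ-+ : ∀ {m} (f g : Vec U m → Carrier) → 𝔼ⱽ (λ xs → f xs + g xs) ≈ 𝔼ⱽ f + 𝔼ⱽ g
    𝔼ⱽ-+ {zero}  f g = refl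
    𝔼ⱽ-+ {suc m} f g = trans
      (∑-cong λ x → trans (*-congˡ (𝔼ⱽ-+ {m} _ _)) (distribˡ (p x) _ _))
      (∑-distrib-+ _ _)

    𝔼ⱽ-∑ : ∀ {m} (f : U → Vec U m → Carrier) → 𝔼ⱽ (λ xs → ∑ λ a → f a xs) ≈ ∑ (λ a → 𝔼ⱽ (f a))
    𝔼ⱽ-∑ {zero}  f = refl
    𝔼ⱽ-∑ {suc m} f = trans
      (∑-cong λ x → trans (*-congˡ (𝔼ⱽ-∑ {m} λ a xs → f a (x ∷ xs))) (sym (∑-*ˡ (p x) _)))
      (∑-comm _)

  module Distribution (0≤p : ∀ a → 0# ≤ p a) (∑p≈1 : ∑ p ≈ 1#) where

    p*p⁻¹≤1 : ∀ a → p a * p a ⁻¹ ≤ 1#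
    p*p⁻¹≤1 a = x*x⁻¹≤1 (p a)

    0≤p⁻¹ : ∀ a → 0# ≤ p a ⁻¹
    0≤p⁻¹ a = ⁻¹-nonneg₀ (0≤p a)

    collisions-nonneg : ∀ {m} (xs : Vec U m) → 0# ≤ collisions xs
    collisions-nonneg xs = ∑-nonneg λ a → *-nonneg (ι-nonneg (occ a xs C 2)) (0≤p⁻¹ a)

    opaque
      unfolding 𝔼ⱽ

      𝔼ⱽ-mono : ∀ {m} {f g : Vec U m → Carrier} → (∀ xs → f xs ≤ g xs) → 𝔼ⱽ f ≤ 𝔼ⱽ g
      𝔼ⱽ-mono {zero}  f≤g = f≤g []
      𝔼ⱽ-mono {suc m} f≤g = ∑-mono λ x → *-monoˡ-≤ (0≤p x) (𝔼ⱽ-mono {m} λ xs → f≤g (x ∷ xs))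

      𝔼ⱽ-const : ∀ {m} k → 𝔼ⱽ {m} (λ _ → k) ≈ k
      𝔼ⱽ-const {zero}  k = refl
      𝔼ⱽ-const {suc m} k = trans (∑-cong λ x → *-congˡ (𝔼ⱽ-const {m} k))
        (trans (∑-*ʳ k p) (trans (*-congʳ ∑p≈1) (*-identityˡ k)))

    -- In every moment recursion k is the part contributed by the earlier draws, which the new draw
    -- x leaves alone.
    ∑p[f+k] : ∀ (f : U → Carrier) k → ∑ (λ x → p x * (f x + k)) ≈ ∑ (λ x → p x * f x) + k
    ∑p[f+k] f k = begin-equality
      ∑ (λ x → p x * (f x + k))              ≈⟨ ∑-cong (λ x → distribˡ (p x) (f x) k) ⟩
      ∑ (λ x → p x * f x + p x * k)          ≈⟨ ∑-distrib-+ _ _ ⟩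
      ∑ (λ x → p x * f x) + ∑ (λ x → p x * k) ≈⟨ +-congˡ (∑-*ʳ k p) ⟩
      ∑ (λ x → p x * f x) + ∑ p * k          ≈⟨ +-congˡ (trans (*-congʳ ∑p≈1) (*-identityˡ k)) ⟩
      ∑ (λ x → p x * f x) + k                ∎

    𝔼ⱽ-occ : ∀ m a → 𝔼ⱽ {m} (λ xs → ι (occ a xs)) ≈ ι m * p a
    𝔼ⱽ-occ zero    a = trans (≡⇒≈ (𝔼ⱽ-zero _)) (sym (zeroˡ _))
    𝔼ⱽ-occ (suc m) a = begin-equality
      𝔼ⱽ (λ xs → ι (occ a xs))
        ≡⟨ 𝔼ⱽ-suc _ ⟩
      ∑ (λ x → p x * 𝔼ⱽ λ xs → ι (occ a (x ∷ xs)))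
        ≈⟨ ∑-cong (λ x → *-congˡ (trans (𝔼ⱽ-cong (ι-occ-∷ a x))
             (trans (𝔼ⱽ-+ _ _) (+-cong (𝔼ⱽ-const (δ a x)) (𝔼ⱽ-occ m a))))) ⟩
      ∑ (λ x → p x * (δ a x + ι m * p a))       ≈⟨ ∑p[f+k] (δ a) (ι m * p a) ⟩
      ∑ (λ x → p x * δ a x) + ι m * p a         ≈⟨ +-congʳ (∑-δʳ a p) ⟩
      p a + ι m * p a                           ≈⟨ solve 2 (λ q k → q :+ k :* q := (con 1 :+ k) :* q)
           refl (p a) (ι m) ⟩
      (1# + ι m) * p a                          ∎

    -- The exact value is m p + m (m - 1) p²; bounding m (m - 1) by m² avoids subtraction and is
    -- sharp enough for the second moment of `collisions`.
    𝔼ⱽ-occ² : ∀ m a → 𝔼ⱽ {m} (λ xs → ι (occ a xs) * ι (occ a xs)) ≤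
                        ι m * p a + ι m * ι m * (p a * p a)
    𝔼ⱽ-occ² zero    a = ≤-reflexive (trans (≡⇒≈ (𝔼ⱽ-zero _))
      (solve 1 (λ q → con 0 :* con 0 := con 0 :* q :+ con 0 :* con 0 :* (q :* q)) refl (p a)))
    𝔼ⱽ-occ² (suc m) a = begin
      𝔼ⱽ (λ xs → ι (occ a xs) * ι (occ a xs))
        ≡⟨ 𝔼ⱽ-suc _ ⟩
      ∑ (λ x → p x * 𝔼ⱽ λ xs → ι (occ a (x ∷ xs)) * ι (occ a (x ∷ xs)))
        ≈⟨ ∑-cong (λ x → *-congˡ (step x)) ⟩
      ∑ (λ x → p x * (δ a x * k + 𝔼ⱽ N²))
        ≈⟨ ∑p[f+k] (λ x → δ a x * k) (𝔼ⱽ N²) ⟩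
      ∑ (λ x → p x * (δ a x * k)) + 𝔼ⱽ N²
        ≈⟨ +-congʳ (trans (∑-cong λ x → sym (*-assoc _ _ _)) (trans (∑-*ʳ k _) (*-congʳ (∑-δʳ a p)))) ⟩
      p a * k + 𝔼ⱽ N²
        ≤⟨ +-monoʳ-≤ (p a * k) (𝔼ⱽ-occ² m a) ⟩
      p a * k + (ι m * p a + ι m * ι m * (p a * p a))
        -- The added square completes the coefficient m² + 2m to (m + 1)².
        ≤⟨ x≤x+y _ (*-nonneg (0≤p a) (0≤p a)) ⟩
      p a * k + (ι m * p a + ι m * ι m * (p a * p a)) + p a * p a
        ≈⟨ solve 2 (λ q j → q :* (con 1 :+ (j :* q :+ j :* q)) :+ (j :* q :+ j :* j :* (q :* q)) :+ q :* q
             := (con 1 :+ j) :* q :+ (con 1 :+ j) :* (con 1 :+ j) :* (q :* q)) refl (p a) (ι m) ⟩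
      (1# + ι m) * p a + (1# + ι m) * (1# + ι m) * (p a * p a) ∎
      where
      N N² : Vec U m → Carrier
      N xs = ι (occ a xs)
      N² xs = N xs * N xs
      k : Carrier
      k = 1# + (ι m * p a + ι m * p a)
      step : ∀ x → 𝔼ⱽ (λ xs → ι (occ a (x ∷ xs)) * ι (occ a (x ∷ xs))) ≈ δ a x * k + 𝔼ⱽ N²
      step x = begin-equality
        𝔼ⱽ (λ xs → ι (occ a (x ∷ xs)) * ι (occ a (x ∷ xs)))
          ≈⟨ 𝔼ⱽ-cong (λ xs → trans (*-cong (ι-occ-∷ a x xs) (ι-occ-∷ a x xs))
               (trans (solve 2 (λ d j → (d :+ j) :* (d :+ j) := d :* d :+ (d :+ d) :* j :+ j :* j)
                    refl (δ a x) (N xs))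
                 (+-congʳ (+-congʳ (δ-idem a x))))) ⟩
        𝔼ⱽ (λ xs → δ a x + (δ a x + δ a x) * N xs + N² xs)
          ≈⟨ trans (𝔼ⱽ-+ _ _)
               (+-congʳ (trans (𝔼ⱽ-+ _ _) (+-cong (𝔼ⱽ-const _) (trans (𝔼ⱽ-*ˡ _ N) (*-congˡ (𝔼ⱽ-occ m a)))))) ⟩
        δ a x + (δ a x + δ a x) * (ι m * p a) + 𝔼ⱽ N²
          ≈⟨ +-congʳ (solve 2 (λ d e → d :+ (d :+ d) :* e := d :* (con 1 :+ (e :+ e)))
               refl (δ a x) (ι m * p a)) ⟩
        δ a x * k + 𝔼ⱽ N² ∎

    -- The event that the new draw is x contributes p x · (p x)⁻¹ · m p x, which is m p x even where
    -- p x = 0. These add up to m, and m + C(m,2) = C(m+1,2).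
    𝔼ⱽ-collisions : ∀ m → 𝔼ⱽ {m} collisions ≈ ι (m C 2)
    𝔼ⱽ-collisions zero    = trans (≡⇒≈ (𝔼ⱽ-zero _)) (trans (∑-cong λ a → zeroˡ _) (∑-occ []))
    𝔼ⱽ-collisions (suc m) = begin-equality
      𝔼ⱽ (λ xs → collisions xs)
        ≡⟨ 𝔼ⱽ-suc _ ⟩
      ∑ (λ x → p x * 𝔼ⱽ λ xs → collisions (x ∷ xs))
        ≈⟨ ∑-cong (λ x → *-congˡ (trans (𝔼ⱽ-cong (collisions-∷ x))
             (trans (𝔼ⱽ-+ _ _) (+-cong (trans (𝔼ⱽ-*ˡ _ _) (*-congˡ (𝔼ⱽ-occ m x))) (𝔼ⱽ-collisions m))))) ⟩
      ∑ (λ x → p x * (p x ⁻¹ * (ι m * p x) + ι (m C 2)))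
        ≈⟨ ∑p[f+k] (λ x → p x ⁻¹ * (ι m * p x)) (ι (m C 2)) ⟩
      ∑ (λ x → p x * (p x ⁻¹ * (ι m * p x))) + ι (m C 2)
        ≈⟨ +-congʳ (trans (∑-cong λ x → term x) (trans (∑-*ˡ (ι m) p) (trans (*-congˡ ∑p≈1) (*-identityʳ _)))) ⟩
      ι m + ι (m C 2)
        ≈⟨ ι-[1+m]C2 m ⟨
      ι (suc m C 2) ∎
      where
      term : ∀ x → p x * (p x ⁻¹ * (ι m * p x)) ≈ ι m * p x
      term x = trans
        (solve 3 (λ q r k → q :* (r :* (k :* q)) := k :* (q :* (r :* q))) refl (p x) (p x ⁻¹) (ι m))
        (*-congˡ (x*[x⁻¹*x]≈x (p x)))

    -- The new sample x adds occ x / p x.  Against the earlier collisions this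
    -- averages to at most m for every fixed outcome xs of the earlier samples,
    -- so the variance only grows by the second moment of the new term.
    𝔼ⱽ-collisions² : ∀ m → 𝔼ⱽ {m} (λ xs → collisions xs * collisions xs) ≤
                             ι (m C 2) * ι (m C 2) + ι n * ι (m C 2)
    𝔼ⱽ-collisions² zero    = ≤-reflexive (trans (≡⇒≈ (𝔼ⱽ-zero _)) (trans (*-congʳ Y≈0)
      (solve 2 (λ y k → con 0 :* y := con 0 :* con 0 :+ k :* con 0) refl (collisions []) (ι n))))
      where
      Y≈0 : collisions [] ≈ 0#
      Y≈0 = trans (≡⇒≈ (≡.sym (𝔼ⱽ-zero collisions))) (𝔼ⱽ-collisions zero)
    𝔼ⱽ-collisions² (suc m) = begin
      𝔼ⱽ (λ xs → collisions xs * collisions xs)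
        ≡⟨ 𝔼ⱽ-suc _ ⟩
      ∑ (λ x → p x * 𝔼ⱽ λ xs → collisions (x ∷ xs) * collisions (x ∷ xs))
        ≈⟨ ∑-cong (λ x → *-congˡ (step x)) ⟩
      ∑ (λ x → p x * (A x + (B x + B x) + 𝔼ⱽ Y²))
        ≈⟨ ∑p[f+k] (λ x → A x + (B x + B x)) (𝔼ⱽ Y²) ⟩
      ∑ (λ x → p x * (A x + (B x + B x))) + 𝔼ⱽ Y²
        ≈⟨ +-congʳ (trans (∑-cong λ x → solve 3 (λ q a b → q :* (a :+ (b :+ b))
               := q :* a :+ (q :* b :+ q :* b))
             refl (p x) (A x) (B x))
             (trans (∑-distrib-+ _ _) (+-congˡ (∑-distrib-+ _ _)))) ⟩
      ∑ (λ x → p x * A x) + (∑ (λ x → p x * B x) + ∑ (λ x → p x * B x)) + 𝔼ⱽ Y²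
        ≤⟨ +-mono-≤ (+-mono-≤ ∑pA≤ (+-mono-≤ ∑pB≤ ∑pB≤)) (𝔼ⱽ-collisions² m) ⟩
      (ι m * ι n + ι m * ι m) + (ι m * b + ι m * b) + (b * b + ι n * b)
        ≈⟨ solve 3 (λ j k b → (j :* k :+ j :* j) :+ (j :* b :+ j :* b) :+ (b :* b :+ k :* b)
             := (j :+ b) :* (j :+ b) :+ k :* (j :+ b)) refl (ι m) (ι n) b ⟩
      (ι m + b) * (ι m + b) + ι n * (ι m + b)
        ≈⟨ +-cong (*-cong (ι-[1+m]C2 m) (ι-[1+m]C2 m)) (*-congˡ (ι-[1+m]C2 m)) ⟨
      ι (suc m C 2) * ι (suc m C 2) + ι n * ι (suc m C 2) ∎
      where
      b : Carrier
      b = ι (m C 2)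
      N : U → Vec U m → Carrier
      N x xs = ι (occ x xs)
      Y Y² : Vec U m → Carrier
      Y = collisions
      Y² xs = Y xs * Y xs
      A B : U → Carrier
      A x = (p x ⁻¹ * p x ⁻¹) * 𝔼ⱽ (λ xs → N x xs * N x xs)
      B x = 𝔼ⱽ (λ xs → Y xs * (p x ⁻¹ * N x xs))

      step : ∀ x → 𝔼ⱽ (λ xs → collisions (x ∷ xs) * collisions (x ∷ xs)) ≈ A x + (B x + B x) + 𝔼ⱽ Y²
      step x = begin-equality
        𝔼ⱽ (λ xs → collisions (x ∷ xs) * collisions (x ∷ xs))
          ≈⟨ 𝔼ⱽ-cong (λ xs → trans (*-cong (collisions-∷ x xs) (collisions-∷ x xs))
               (solve 3 (λ q k y → (q :* k :+ y) :* (q :* k :+ y)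
                
                        := (q :* q) :* (k :* k) :+ (y :* (q :* k) :+ y :* (q :* k)) :+ y :* y) refl (p x ⁻¹) (N x xs) (Y xs))) ⟩
        𝔼ⱽ (λ xs → (p x ⁻¹ * p x ⁻¹) * (N x xs * N x xs)
                     + (Y xs * (p x ⁻¹ * N x xs) + Y xs * (p x ⁻¹ * N x xs)) + Y² xs)
          ≈⟨ trans (𝔼ⱽ-+ _ _) (+-congʳ (trans (𝔼ⱽ-+ _ _) (+-cong (𝔼ⱽ-*ˡ _ _) (𝔼ⱽ-+ _ _)))) ⟩
        A x + (B x + B x) + 𝔼ⱽ Y² ∎

      q : U → Carrier
      q x = p x * p x ⁻¹
      0≤q : ∀ x → 0# ≤ q x
      0≤q x = *-nonneg (0≤p x) (0≤p⁻¹ x)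

      -- The only source of n: after the weights cancel, an item contributes at most m + m² p x, and
      -- the first term, free of p x, is counted once per item.
      ∑pA≤ : ∑ (λ x → p x * A x) ≤ ι m * ι n + ι m * ι m
      ∑pA≤ = begin
        ∑ (λ x → p x * A x)
          ≤⟨ ∑-mono pA≤ ⟩
        ∑ (λ x → ι m * 1# + ι m * ι m * p x)
          ≈⟨ trans (∑-distrib-+ _ _) (+-cong (trans (∑-*ˡ _ _) (*-congˡ ∑-1))
               (trans (∑-*ˡ _ _) (trans (*-congˡ ∑p≈1) (*-identityʳ _)))) ⟩
        ι m * ι n + ι m * ι m ∎
        where
        pA≤ : ∀ x → p x * A x ≤ ι m * 1# + ι m * ι m * p x
        pA≤ x = begin
          p x * A x
            ≤⟨ *-monoˡ-≤ (0≤p x) (*-monoˡ-≤ (*-nonneg (0≤p⁻¹ x) (0≤p⁻¹ x)) (𝔼ⱽ-occ² m x)) ⟩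
          p x * ((p x ⁻¹ * p x ⁻¹) * (ι m * p x + ι m * ι m * (p x * p x)))
            ≈⟨ solve 3 (λ s r j → s :* ((r :* r) :* (j :* s :+ j :* j :* (s :* s)))
                 := (j :* con 1 :+ j :* j :* s) :* ((s :* r) :* (s :* r))) refl (p x) (p x ⁻¹) (ι m) ⟩
          (ι m * 1# + ι m * ι m * p x) * (q x * q x)
            ≤⟨ *-monoˡ-≤ (+-nonneg (*-nonneg (ι-nonneg m) 0≤1) (*-nonneg (*-nonneg (ι-nonneg m) (ι-nonneg m)) (0≤p x)))
                 (*-mono-≤ (0≤q x) 0≤1 (p*p⁻¹≤1 x) (p*p⁻¹≤1 x)) ⟩
          (ι m * 1# + ι m * ι m * p x) * (1# * 1#)
            ≈⟨ trans (*-congˡ (*-identityʳ 1#)) (*-identityʳ _) ⟩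
          ι m * 1# + ι m * ι m * p x ∎

      ∑pB≤ : ∑ (λ x → p x * B x) ≤ ι m * b
      ∑pB≤ = begin
        ∑ (λ x → p x * B x)
          ≈⟨ ∑-cong (λ x → sym (𝔼ⱽ-*ˡ (p x) _)) ⟩
        ∑ (λ x → 𝔼ⱽ λ xs → p x * (Y xs * (p x ⁻¹ * N x xs)))
          ≈⟨ 𝔼ⱽ-∑ _ ⟨
        𝔼ⱽ (λ xs → ∑ λ x → p x * (Y xs * (p x ⁻¹ * N x xs)))
          ≤⟨ 𝔼ⱽ-mono average≤ ⟩
        𝔼ⱽ (λ xs → ι m * Y xs)
          ≈⟨ trans (𝔼ⱽ-*ˡ _ _) (*-congˡ (𝔼ⱽ-collisions m)) ⟩
        ι m * b ∎
        where
        average≤ : ∀ xs → ∑ (λ x → p x * (Y xs * (p x ⁻¹ * N x xs))) ≤ ι m * Y xs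
        average≤ xs = begin
          ∑ (λ x → p x * (Y xs * (p x ⁻¹ * N x xs)))
            ≈⟨ ∑-cong (λ x → solve 4 (λ s y r k → s :* (y :* (r :* k)) := (s :* r) :* (k :* y))
                 refl (p x) (Y xs) (p x ⁻¹) (N x xs)) ⟩
          ∑ (λ x → q x * (N x xs * Y xs))
            ≤⟨ ∑-mono (λ x → *-monoʳ-≤ (*-nonneg (ι-nonneg (occ x xs)) (collisions-nonneg xs)) (p*p⁻¹≤1 x)) ⟩
          ∑ (λ x → 1# * (N x xs * Y xs))
            ≈⟨ ∑-cong (λ x → *-identityˡ _) ⟩
          ∑ (λ x → N x xs * Y xs)
            ≈⟨ trans (∑-*ʳ _ _) (*-congʳ (∑-occ xs)) ⟩
          ι m * Y xs ∎

-- From the estimator to the collision count.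

module Estimation {c ℓ} (R : CompleteOrderedField c ℓ)
                  {u} {U : Set u} {n : ℕ} (enum : U ↔ Fin n)
                  (w : U → CompleteOrderedField.Carrier R) where

  open ProportionalSampling R enum w using (W; 𝔼; ℙ)

  p : U → CompleteOrderedField.Carrier R
  p a = w a / W
    where open RealArithmetic R

  open Collisions R enum p
  open Inverse enum using (from)
  open ≤-Reasoning

  tag : U → Sample
  tag a = a , w a

  samples : ∀ {m} → Vec U m → List Sample
  samples xs = toList (Vec.map tag xs)

  -- The weight in a sample is determined by its item, so a run of the sampler is a vector of items
  -- and its expectation is an instance of `𝔼ⱽ`.
  𝔼-drawVec : ∀ {a} {A : Set a} m (g : Vec Sample m → A) f →
              𝔼 (drawVec m (return ∘ g)) f ≈ 𝔼ⱽ (λ xs → f (g (Vec.map tag xs)))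
  𝔼-drawVec zero    g f = ≡⇒≈ (≡.sym (𝔼ⱽ-zero _))
  𝔼-drawVec (suc m) g f = trans (≡⇒≈ (≡.sym (∑-def _))) (trans
    (∑-cong λ a → *-congˡ (𝔼-drawVec m (g ∘ (tag a ∷_)) f))
    (≡⇒≈ (≡.sym (𝔼ⱽ-suc _))))

  term : List Sample → Sample → Carrier
  term as s = ι (multiplicity as s C 2) / proj₂ s

  estimateSum : List Sample → Carrier
  estimateSum as = foldr _+_ 0# (List.map (term as) (distinct as))

  foldr-one≈0 : ∀ as {S} → All (λ s → multiplicity as s ≡ 1) S →
                foldr _+_ 0# (List.map (term as) S) ≈ 0#
  foldr-one≈0 as All.[]           = refl
  foldr-one≈0 as (k≡1 All.∷ all) = trans
    (+-cong (trans (*-congʳ (≡⇒≈ (≡.cong (λ k → ι (k C 2)) k≡1))) (zeroˡ _)) (foldr-one≈0 as all))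
    (+-identityʳ 0#)

  -- The output ∞ fits the formula: when all multiplicities are 1, every C(1,2) vanishes and the sum
  -- is 0, in agreement with `recip ∞`.
  recip-estimate : ∀ m as → recip (estimate m as) ≈ ι (m C 2) ⁻¹ * estimateSum as
  recip-estimate m as with all? (λ s → multiplicity as s ℕ.≟ 1) (distinct as)
  ... | yes all = sym (trans (*-congˡ (foldr-one≈0 as all)) (zeroʳ _))
  ... | no  _   = trans (⁻¹-distrib-* _ _) (*-congˡ (⁻¹-involutive _))

  estimate-finite : ∀ m as → ¬ estimateSum as ≈ 0# →
                    estimate m as ≡ fin (ι (m C 2) * estimateSum as ⁻¹)
  estimate-finite m as Z≉0 with all? (λ s → multiplicity as s ℕ.≟ 1) (distinct as)
  ... | yes all = ⊥-elim (Z≉0 (foldr-one≈0 as all))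
  ... | no  _   = ≡.refl

  -- Repeated items are allowed, each counted with its multiplicity, so a plain list induction
  -- works. `tag a` is just a representative, since `multiplicity` ignores the weight.
  foldr-∑ : ∀ {f} (h : U → Carrier) {S} → All (λ s → f s ≈ h (proj₁ s)) S →
            foldr _+_ 0# (List.map f S) ≈ ∑ (λ a → ι (multiplicity S (tag a)) * h a)
  foldr-∑ h All.[] = sym (trans (∑-*ˡ 0# h) (zeroˡ _))
  foldr-∑ {f} h {s List.∷ S} (fs≈hs All.∷ all) = begin-equality
    f s + foldr _+_ 0# (List.map f S)
      ≈⟨ +-cong fs≈hs (foldr-∑ h all) ⟩
    h x + ∑ (λ a → ι (multiplicity S (tag a)) * h a)
      ≈⟨ +-congʳ (∑-δˡ x h) ⟨
    ∑ (λ a → δ a x * h a) + ∑ (λ a → ι (multiplicity S (tag a)) * h a)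
      ≈⟨ ∑-distrib-+ _ _ ⟨
    ∑ (λ a → δ a x * h a + ι (multiplicity S (tag a)) * h a)
      ≈⟨ ∑-cong (λ a → trans (*-congʳ (ι-multiplicity-∷ s S (tag a))) (distribʳ (h a) _ _)) ⟨
    ∑ (λ a → ι (multiplicity (s List.∷ S) (tag a)) * h a) ∎
    where
    x : U
    x = proj₁ s

  samples-weighted : ∀ {m} (xs : Vec U m) → All (λ s → proj₂ s ≡ w (proj₁ s)) (samples xs)
  samples-weighted []       = All.[]
  samples-weighted (x ∷ xs) = ≡.refl All.∷ samples-weighted xs

  estimateSum-samples : ∀ {m} (xs : Vec U m) →
    estimateSum (samples xs) ≈ ∑ (λ a → ι (occ a xs C 2) * w a ⁻¹)
  estimateSum-samples xs = trans
    (foldr-∑ h (All.map h-term (All.deduplicate⁺ _ (samples-weighted xs))))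
    (∑-cong step)
    where
    as : List Sample
    as = samples xs
    h : U → Carrier
    h a = ι (occ a xs C 2) * w a ⁻¹
    h-term : ∀ {s} → proj₂ s ≡ w (proj₁ s) → term as s ≈ h (proj₁ s)
    h-term {s} e = ≡⇒≈ (≡.cong₂ (λ k y → ι (k C 2) * y ⁻¹) (multiplicity-map w xs s) e)
    once : ∀ k y → ι (1 ℕ.⊓ k) * (ι (k C 2) * y) ≈ ι (k C 2) * y
    once zero    y = trans (zeroˡ _) (sym (zeroˡ y))
    once (suc k) y = trans (*-congʳ (+-identityʳ 1#)) (*-identityˡ _)
    step : ∀ a → ι (multiplicity (distinct as) (tag a)) * h a ≈ h a
    step a = trans
      (*-congʳ (≡⇒≈ (≡.cong ι (≡.trans (multiplicity-distinct as (tag a))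
        (≡.cong (1 ℕ.⊓_) (multiplicity-map w xs (tag a)))))))
      (once (occ a xs) (w a ⁻¹))

  estimateSum-W : ∀ {m} (xs : Vec U m) → estimateSum (samples xs) * W ≈ collisions xs
  estimateSum-W xs = begin-equality
    estimateSum (samples xs) * W
      ≈⟨ *-congʳ (estimateSum-samples xs) ⟩
    ∑ (λ a → ι (occ a xs C 2) * w a ⁻¹) * W
      ≈⟨ ∑-*ʳ W _ ⟨
    ∑ (λ a → ι (occ a xs C 2) * w a ⁻¹ * W)
      ≈⟨ ∑-cong (λ a → trans (*-assoc _ _ _) (*-congˡ (sym
           (trans (⁻¹-distrib-* (w a) (W ⁻¹)) (*-congˡ (⁻¹-involutive W)))))) ⟩
    collisions xs ∎

  module Positive (0≤w : ∀ a → 0# ≤ w a) (0<W : 0# < W) where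

    0≤p : ∀ a → 0# ≤ p a
    0≤p a = *-nonneg (0≤w a) (⁻¹-nonneg 0<W)

    ∑p≈1 : ∑ p ≈ 1#
    ∑p≈1 = trans (∑-*ʳ (W ⁻¹) w)
      (trans (*-congʳ (≡⇒≈ (∑-def w))) (⁻¹-inverseʳ (proj₂ 0<W ∘ sym)))

    open Distribution 0≤p ∑p≈1

    𝔼-recip : ∀ m → 0# < ι (m C 2) →
              𝔼 (drawVec m (return ∘ estimate m ∘ toList)) recip ≈ 1# / W
    𝔼-recip m 0<b = begin-equality
      𝔼 (drawVec m (return ∘ estimate m ∘ toList)) recip
        ≈⟨ 𝔼-drawVec m (estimate m ∘ toList) recip ⟩
      𝔼ⱽ {m} (λ xs → recip (estimate m (samples xs)))
        ≈⟨ 𝔼ⱽ-cong recip≈ ⟩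
      𝔼ⱽ {m} (λ xs → ι (m C 2) ⁻¹ * W ⁻¹ * collisions xs)
        ≈⟨ trans (𝔼ⱽ-*ˡ _ _) (*-congˡ (𝔼ⱽ-collisions m)) ⟩
      ι (m C 2) ⁻¹ * W ⁻¹ * ι (m C 2)
        ≈⟨ solve 3 (λ r v b → r :* v :* b := b :* r :* v) refl (ι (m C 2) ⁻¹) (W ⁻¹) (ι (m C 2)) ⟩
      ι (m C 2) * ι (m C 2) ⁻¹ * W ⁻¹
        ≈⟨ *-congʳ (⁻¹-inverseʳ (proj₂ 0<b ∘ sym)) ⟩
      1# / W ∎
      where
      recip≈ : ∀ xs → recip (estimate m (samples xs)) ≈ ι (m C 2) ⁻¹ * W ⁻¹ * collisions {m} xs
      recip≈ xs = begin-equality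
        recip (estimate m (samples xs))              ≈⟨ recip-estimate m (samples xs) ⟩
        ι (m C 2) ⁻¹ * Z                             ≈⟨ *-congˡ (trans (sym (*-identityˡ Z)) (*-congʳ (sym (⁻¹-inverseʳ (proj₂ 0<W ∘ sym))))) ⟩
        ι (m C 2) ⁻¹ * (W * W ⁻¹ * Z)                ≈⟨ solve 4 (λ r W v Z → r :* (W :* v :* Z)
               := r :* v :* (Z :* W))
             refl (ι (m C 2) ⁻¹) W (W ⁻¹) Z ⟩
        ι (m C 2) ⁻¹ * W ⁻¹ * (Z * W)                ≈⟨ *-congˡ (estimateSum-W xs) ⟩
        ι (m C 2) ⁻¹ * W ⁻¹ * collisions xs          ∎
        where
        Z : Carrier
        Z = estimateSum (samples xs)

    -- Concentration of the estimate.

    module _ (m : ℕ) (ε : Carrier) (0<ε : 0# < ε) (ε<1 : ε < 1#) (0<b : 0# < ι (m C 2)) where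

      -- The good event |Y - b| ≤ ε b / 2 is used in its doubled form |2Y - B| ≤ e, which needs no
      -- division by 2.
      b e B : Carrier
      b = ι (m C 2)
      e = ε * b
      B = b + b

      0≤e : 0# ≤ e
      0≤e = *-nonneg (proj₁ 0<ε) (proj₁ 0<b)

      -- Multiplied by Z, where Z W = Y, the goal |b / Z - W| ≤ ε W reads |b - Y| ≤ ε Y, a tolerance
      -- relative to Y instead of b. The first hypothesis and ε < 1 give b ≤ 2Y, hence e ≤ 2 ε Y;
      -- this factor 2 is why the good event has tolerance ε b / 2. The same bound makes Z nonzero,
      -- so the output is finite.
      estimate-close : ∀ xs → B ≤ collisions {m} xs + collisions xs + e →
                       collisions xs + collisions xs ≤ B + e →
                       dist (estimate m (samples xs)) W ≤∞ ε * W
      estimate-close xs B≤2Y+e 2Y≤B+e =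
        ≡.subst (λ z → dist z W ≤∞ ε * W) (≡.sym (estimate-finite m (samples xs) Z≉0))
          (∣x-y∣≤k
            (*-cancelʳ-≤ 0<Z (≤-resp (sym b/Z*Z≈b) Y+εY≈ b≤Y+εY))
            (*-cancelʳ-≤ 0<Z (≤-resp (trans (sym ZW≈Y) (*-comm Z W)) b+εY≈ Y≤b+εY)))
        where
        Y Z : Carrier
        Y = collisions xs
        Z = estimateSum (samples xs)

        ZW≈Y : Z * W ≈ Y
        ZW≈Y = estimateSum-W xs

        b≤2Y : b ≤ Y + Y
        b≤2Y = +-cancelʳ-≤ b (≤-trans B≤2Y+e
          (+-monoʳ-≤ (Y + Y) (≤-resp refl (*-identityˡ b) (*-monoʳ-≤ (proj₁ 0<b) (proj₁ ε<1)))))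

        Z≉0 : ¬ Z ≈ 0#
        Z≉0 Z≈0 = <⇒≱ 0<b (≤-resp refl (trans (+-cong Y≈0 Y≈0) (+-identityʳ 0#)) b≤2Y)
          where
          Y≈0 : Y ≈ 0#
          Y≈0 = trans (sym ZW≈Y) (trans (*-congʳ Z≈0) (zeroˡ W))

        0<Z : 0# < Z
        0<Z = *-cancelʳ-≤ 0<W (≤-resp (sym (zeroˡ W)) (sym ZW≈Y) (collisions-nonneg xs)) , Z≉0 ∘ sym

        e≤2εY : e ≤ ε * Y + ε * Y
        e≤2εY = ≤-resp refl (distribˡ ε Y Y) (*-monoˡ-≤ (proj₁ 0<ε) b≤2Y)

        b≤Y+εY : b ≤ Y + ε * Y
        b≤Y+εY = +-halve-≤ (≤-trans B≤2Y+e (≤-resp refl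
          (solve 2 (λ y z → y :+ y :+ (z :+ z) := y :+ z :+ (y :+ z)) refl Y (ε * Y))
          (+-monoʳ-≤ (Y + Y) e≤2εY)))

        Y≤b+εY : Y ≤ b + ε * Y
        Y≤b+εY = +-halve-≤ (≤-trans 2Y≤B+e (≤-resp refl
          (solve 2 (λ y z → y :+ y :+ (z :+ z) := y :+ z :+ (y :+ z)) refl b (ε * Y))
          (+-monoʳ-≤ B e≤2εY)))

        b/Z*Z≈b : b / Z * Z ≈ b
        b/Z*Z≈b = x/y*y≈x b 0<Z

        εWZ≈εY : ε * W * Z ≈ ε * Y
        εWZ≈εY = trans (*-assoc _ _ _) (*-congˡ (trans (*-comm W Z) ZW≈Y))

        Y+εY≈ : Y + ε * Y ≈ (W + ε * W) * Z
        Y+εY≈ = sym (trans (distribʳ Z W (ε * W)) (+-cong (trans (*-comm W Z) ZW≈Y) εWZ≈εY))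

        b+εY≈ : b + ε * Y ≈ (b / Z + ε * W) * Z
        b+εY≈ = sym (trans (distribʳ Z (b / Z) (ε * W)) (+-cong b/Z*Z≈b εWZ≈εY))

      close? : ∀ Ŵ → Dec (dist Ŵ W ≤∞ ε * W)
      close? Ŵ = dist Ŵ W ≤∞? ε * W

      hit : Vec U m → Carrier
      hit xs = if ⌊ close? (estimate m (samples xs)) ⌋ then 1# else 0#

      -- Chebyshev's inequality before averaging: e² (1 - hit) ≤ (2Y - 2b)², with
      -- the negative terms moved to the other side.
      chebyshev : ∀ xs → let V = collisions xs + collisions xs in
                  e * e + (B * V + B * V) ≤ e * e * hit xs + (V * V + B * B)
      chebyshev xs with close? (estimate m (samples xs))
      ... | yes _ = +-mono-≤ (≤-reflexive (sym (*-identityʳ (e * e)))) (2xy≤x²+y² B _)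
      ... | no ¬close with B ≤? collisions xs + collisions xs + e
                         | collisions xs + collisions xs ≤? B + e
      ...   | yes B≤ | yes ≤B = ⊥-elim (¬close (estimate-close xs B≤ ≤B))
      ...   | no B≰  | _      = ≤-resp refl
        (sym (trans (+-congʳ (zeroʳ _)) (+-identityˡ _)))
        (e²+2xy≤x²+y² 0≤e (≰⇒≥ B≰))
      ...   | yes _  | no ≰B  = ≤-resp (+-congˡ (+-cong (*-comm _ B) (*-comm _ B)))
        (trans (+-comm _ _) (sym (trans (+-congʳ (zeroʳ _)) (+-identityˡ _))))
        (e²+2xy≤x²+y² 0≤e (≰⇒≥ ≰B))

      -- The cross terms of `chebyshev` average to 8 b². On the other side B² and the b² part of
      -- four times the second moment also make 8 b²; cancelling leaves 4 n b, the variance bound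
      -- for 2Y.
      𝔼ⱽ-chebyshev : e * e ≤ e * e * 𝔼ⱽ hit + ι 4 * (ι n * b)
      𝔼ⱽ-chebyshev = +-cancelʳ-≤ (ι 8 * b * b) (begin
        e * e + ι 8 * b * b
          ≈⟨ trans (𝔼ⱽ-+ _ _) (+-cong (𝔼ⱽ-const _) (trans (𝔼ⱽ-*ˡ _ _) (*-congˡ (𝔼ⱽ-collisions m)))) ⟨
        𝔼ⱽ (λ xs → e * e + ι 8 * b * Y xs)
          ≤⟨ 𝔼ⱽ-mono pointwise ⟩
        𝔼ⱽ (λ xs → e * e * hit xs + (ι 4 * (Y xs * Y xs) + B * B))
          ≈⟨ trans (𝔼ⱽ-+ _ _) (+-cong (𝔼ⱽ-*ˡ _ _) (trans (𝔼ⱽ-+ _ _) (+-cong (𝔼ⱽ-*ˡ _ _) (𝔼ⱽ-const _)))) ⟩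
        e * e * 𝔼ⱽ hit + (ι 4 * 𝔼ⱽ (λ xs → Y xs * Y xs) + B * B)
          ≤⟨ +-monoʳ-≤ _ (+-monoˡ-≤ _ (*-monoˡ-≤ (ι-nonneg 4) (𝔼ⱽ-collisions² m))) ⟩
        e * e * 𝔼ⱽ hit + (ι 4 * (b * b + ι n * b) + B * B)
          ≈⟨ solve 3 (λ x b n → x :+ (ι′ 4 :* (b :* b :+ n :* b) :+ (b :+ b) :* (b :+ b))
               := x :+ ι′ 4 :* (n :* b) :+ ι′ 8 :* b :* b) refl (e * e * 𝔼ⱽ hit) b (ι n) ⟩
        e * e * 𝔼ⱽ hit + ι 4 * (ι n * b) + ι 8 * b * b ∎)
        where
        Y : Vec U m → Carrier
        Y = collisions
        pointwise : ∀ xs → e * e + ι 8 * b * Y xs ≤ e * e * hit xs + (ι 4 * (Y xs * Y xs) + B * B)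
        pointwise xs = ≤-resp
          (+-congˡ (solve 2 (λ b y → (b :+ b) :* (y :+ y) :+ (b :+ b) :* (y :+ y) := ι′ 8 :* b :* y)
               refl b (Y xs)))
          (+-congˡ (+-congʳ (solve 1 (λ y → (y :+ y) :* (y :+ y) := ι′ 4 :* (y :* y)) refl (Y xs))))
          (chebyshev xs)

      2/3≤ℙ : ι 24 * ι n ≤ ε * ε * (ι 2 * b) →
              ι 2 / ι 3 ≤ ℙ (drawVec m (return ∘ estimate m ∘ toList)) close?
      2/3≤ℙ 24n≤2ε²b = *-cancelʳ-≤ (ι-positive 2) (≤-resp (sym (x/y*y≈x (ι 2) (ι-positive 2)))
        (*-congʳ (sym (𝔼-drawVec m (estimate m ∘ toList) _)))
        -- Cleared of denominators, the claim is 3 e² ≤ 3 e² `𝔼ⱽ hit` + e²; the last e² pays for the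
        -- variance term 12 n b.
        (*-cancelˡ-≤ (*-positive 0<e 0<e) (+-cancelʳ-≤ (e * e) (begin
          e * e * ι 2 + e * e
            ≈⟨ solve 1 (λ x → x :* ι′ 2 :+ x := ι′ 3 :* x) refl (e * e) ⟩
          ι 3 * (e * e)
            ≤⟨ *-monoˡ-≤ (ι-nonneg 3) 𝔼ⱽ-chebyshev ⟩
          ι 3 * (e * e * 𝔼ⱽ hit + ι 4 * (ι n * b))
            ≈⟨ solve 4 (λ x h n b → ι′ 3 :* (x :* h :+ ι′ 4 :* (n :* b))
                   := x :* (h :* ι′ 3) :+ ι′ 12 :* n :* b)
                 refl (e * e) (𝔼ⱽ hit) (ι n) b ⟩
          e * e * (𝔼ⱽ hit * ι 3) + ι 12 * ι n * b
            ≤⟨ +-monoʳ-≤ _ (*-monoʳ-≤ (proj₁ 0<b) 12n≤ε²b) ⟩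
          e * e * (𝔼ⱽ hit * ι 3) + ε * ε * b * b
            ≈⟨ +-congˡ (solve 2 (λ x b → x :* x :* b :* b := (x :* b) :* (x :* b)) refl ε b) ⟩
          e * e * (𝔼ⱽ hit * ι 3) + e * e ∎))))
        where
        0<e : 0# < e
        0<e = *-positive 0<ε 0<b
        12n≤ε²b : ι 12 * ι n ≤ ε * ε * b
        12n≤ε²b = +-halve-≤ (≤-resp
          (solve 1 (λ n → ι′ 24 :* n := ι′ 12 :* n :+ ι′ 12 :* n) refl (ι n))
          (solve 2 (λ x b → x :* (ι′ 2 :* b) := x :* b :+ x :* b) refl (ε * ε) b)
          24n≤2ε²b)

-- Sample count and assembly.

drawVec-UsesAtMost : ∀ {x a} {X : Set x} {A : Set a} m (g : Vec X m → A) →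
                     UsesAtMost m (drawVec m (Sampler.return ∘ g))
drawVec-UsesAtMost zero    g = return
drawVec-UsesAtMost (suc m) g = draw λ s → drawVec-UsesAtMost m (g ∘ (s ∷_))

theorem4 : ∀ {c ℓ u} (R : CompleteOrderedField c ℓ) →
    let open RealArithmetic R in
    ∃ λ (K : Carrier) →
    ∀ {U : Set u} {n : ℕ} (enum : U ↔ Fin n) (w : U → Carrier) →
    let open ProportionalSampling R enum w in
    (∀ a → 0# ≤ w a) → 0# < W →
    ∀ (ñ ε : Carrier) → 1# ≤ ñ → 0# < ε → ε < 1# →
    (∃ λ k → UsesAtMost k (propEstimator ñ ε) × ι k ≤ K * (√ ñ / ε))
    × 𝔼 (propEstimator ñ ε) recip ≈ 1# / W
    × (ι n ≤ ñ →
    ι 2 / ι 3 ≤ ℙ (propEstimator ñ ε) (λ Ŵ → dist Ŵ W ≤∞? ε * W))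
theorem4 R = ι 7 , λ {U} {n} enum w 0≤w 0<W ñ ε 1≤ñ 0<ε ε<1 →
  let open SampleSize 1≤ñ 0<ε ε<1 using (k; 24ñ≤2ε²b; 0<b; m≤7√ñ/ε)
      open ProportionalSampling R enum w using (estimate)
      open Estimation R enum w using (module Positive)
      open Positive 0≤w 0<W using (𝔼-recip; 2/3≤ℙ)
      m = k ℕ.+ 1
  in (m , drawVec-UsesAtMost m (estimate m ∘ toList) , m≤7√ñ/ε)
   , 𝔼-recip m 0<b
   -- The variance involves the true n while m was chosen from ñ; n ≤ ñ bridges the two.
   , λ n≤ñ → 2/3≤ℙ m ε 0<ε ε<1 0<b (≤-trans (*-monoˡ-≤ (ι-nonneg 24) n≤ñ) 24ñ≤2ε²b)
  where
  open RealProperties R
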